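{- There is a constant $c>0$ such that for every sufficiently large $n$ that is a perfect square, every deterministic $\mathsf{Online}$-$\mathsf{LOCAL}$ algorithm that properly 3-colors every $(\sqrt{n}\times\sqrt{n})$ simple grid (for every identifier assignment and every processing order chosen by the adversary) has locality $T(n)\ge c\log n$. In other words, the locality of 3-coloring $(\sqrt{n}\times\sqrt{n})$ simple grids in the $\mathsf{Online}$-$\mathsf{LOCAL}$ model is $\Omega(\log n)$.
   Context: For a graph $G=(V,E)$, $U\subseteq V$ and an integer $T\ge 0$, $\mathcal{B}(U,T)$ denotes the set of nodes at distance at most $T$ from some node of $U$, and $G[U]$ denotes the induced subgraph. The $\mathsf{Online}$-$\mathsf{LOCAL}$ model: an algorithm with locality $T=T(n)$ is deterministic and knows $n$. The adversary chooses an $n$-node input graph $G=(V,E)$ from the input family, assigns distinct identifiers from $\{1,\dots,\mathrm{poly}(n)\}$ to its nodes, and chooses an ordering $\sigma=(v_1,\dots,v_n)$ of $V$. For $i=1,\dots,n$, when $v_i$ is presented, the algorithm must irrevocably assign an output (here a color) to $v_i$ as a function of the sequence $(v_1,\dots,v_i)$ and the induced subgraph $G_i=G\big[\bigcup_{j\le i}\mathcal{B}(v_j,T)\big]$ (with identifiers); thus the algorithm has global memory of everything seen so far. The algorithm solves a coloring problem on an input family if for every choice of the adversary the final coloring is proper and uses only the allowed colors. The locality of a problem is the minimum locality of an algorithm solving it. An $(a\times b)$ simple grid has node set $\{(i,j): i\in[a], j\in[b]\}$, with $(i,j)$ and $(i',j')$ adjacent iff $|i-i'|+|j-j'|=1$.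 -}

module Defs where

open import Level using (0ℓ)
open import Data.Bool using (Bool)
open import Data.Nat using (ℕ; zero; suc; _+_; _*_; _^_; _≤_; ∣_-_∣)
import Data.Nat.Properties as ℕ
open import Data.Fin using (Fin; toℕ)
import Data.Fin.Properties as Fin
open import Data.Fin.Subset using (Subset)
open import Data.List using (List; map; take; tabulate)
open import Data.List.Relation.Unary.Any using (Any)
import Data.List.Relation.Unary.Any as Any
import Data.Vec as Vec
open import Data.Vec using (Vec)
open import Data.Product using (∃; ∃-syntax; _×_; _,_)
open import Data.Sum using (_⊎_; inj₁; inj₂)
open import Function using (_∘_)
open import Function.Bundles using (Inverse; _↔_)
open import Function.Construct.Symmetry using (↔-sym)
open import Function.Definitions using (Injective)
open import Function.Properties.Inverse using (↔⇒↣)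
open import Relation.Binary using (Rel; Symmetric; Irreflexive; DecidableEquality)
import Relation.Binary as B
open import Relation.Nullary using (Dec; does)
open import Relation.Nullary.Decidable using (map′; _×-dec_; _⊎-dec_; via-injection)
open import Relation.Unary using (Pred; Decidable)
open import Relation.Binary.PropositionalEquality
  using (_≡_; _≢_; refl; sym; trans; cong₂; subst)

-- Finite simple undirected graphs.
record Graph : Set₁ where
  field
    V         : Set
    order     : ℕ
    enum      : V ↔ Fin order
    Adj       : Rel V 0ℓ
    Adj?      : B.Decidable Adj
    Adj-sym   : Symmetric Adj
    Adj-irref : Irreflexive _≡_ Adj

  _≟V_ : DecidableEquality V
  _≟V_ = via-injection (↔⇒↣ enum) Fin._≟_

  any-V? : ∀ {P : Pred V 0ℓ} → Decidable P → Dec (∃ P)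
  any-V? {P} P? = map′
    (λ (i , p) → Inverse.from enum i , p)
    (λ (v , p) → Inverse.to enum v , subst P (sym (Inverse.strictlyInverseʳ enum v)) p)
    (Fin.any? (P? ∘ Inverse.from enum))

-- Dist≤ G t u v: some walk from u to v has at most t edges.
data Dist≤ (G : Graph) : ℕ → Rel (Graph.V G) 0ℓ where
  here : ∀ {t u} → Dist≤ G t u u
  step : ∀ {t u v w} → Graph.Adj G u w → Dist≤ G t w v → Dist≤ G (suc t) u v

Dist≤? : ∀ G t → B.Decidable (Dist≤ G t)
Dist≤? G zero u v = map′ (λ { refl → here }) (λ { here → refl }) (u ≟V v)
  where open Graph G
Dist≤? G (suc t) u v = map′
    (λ { (inj₁ refl) → here ; (inj₂ (_ , a , d)) → step a d })
    (λ { here → inj₁ refl ; (step a d) → inj₂ (_ , a , d) })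
    (u ≟V v ⊎-dec any-V? λ w → Adj? u w ×-dec Dist≤? G t w v)
  where open Graph G

-- Ball G U t is 𝓑(U, t), which is also the union of the balls 𝓑(u, t) over u in U.
Ball : ∀ G → List (Graph.V G) → ℕ → Pred (Graph.V G) 0ℓ
Ball G U t v = Any (λ u → Dist≤ G t u v) U

Ball? : ∀ G U t → Decidable (Ball G U t)
Ball? G U t v = Any.any? (λ u → Dist≤? G t u v) U

simpleGrid : ℕ → ℕ → Graph
simpleGrid a b = record
  { V         = Fin a × Fin b
  ; order     = a * b
  ; enum      = ↔-sym Fin.*↔×
  ; Adj       = λ (i , j) (i′ , j′) → ∣ toℕ i - toℕ i′ ∣ + ∣ toℕ j - toℕ j′ ∣ ≡ 1
  ; Adj?      = λ (i , j) (i′ , j′) → ∣ toℕ i - toℕ i′ ∣ + ∣ toℕ j - toℕ j′ ∣ ℕ.≟ 1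
  ; Adj-sym   = λ { {i , j} {i′ , j′} e → trans
      (cong₂ _+_ (ℕ.∣-∣-comm (toℕ i′) (toℕ i)) (ℕ.∣-∣-comm (toℕ j′) (toℕ j))) e }
  ; Adj-irref = λ { {i , j} refl e → ℕ.0≢1+n (trans
      (sym (cong₂ _+_ (ℕ.∣n-n∣≡0 (toℕ i)) (ℕ.∣n-n∣≡0 (toℕ j)))) e) }
  }

-- The "poly(n)" bounding the identifiers of n-node graphs: polynomially bounded, and
-- large enough for n distinct identifiers to exist.
record IdentifierSpace : Set where
  field
    size       : ℕ → ℕ
    enough     : ∀ n → n ≤ size n
    polynomial : ∃[ k ] ∀ n → size n ≤ n ^ k + k

-- What an algorithm has seen after some steps, in terms of identifiers Fin N (standing for
-- {1, …, N}): the sequence of presented nodes, and the node set and adjacency matrix of the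
-- revealed induced subgraph. Vectors of Booleans give one value of View per labelled graph,
-- so a function on View cannot depend on anything but the labelled graph and the sequence.
record View (N : ℕ) : Set where
  constructor mkView
  field
    presented : List (Fin N)
    nodes     : Subset N
    adjacency : Vec (Vec Bool N) N

-- Deterministic Online-LOCAL algorithms with outputs in {0, …, q - 1}.
record Algorithm (I : IdentifierSpace) (q : ℕ) : Set where
  field
    locality : ℕ → ℕ
    output   : ∀ n → View (IdentifierSpace.size I n) → Fin q

-- The adversary's choices on an input graph: identifiers and a processing order.
record Adversary (I : IdentifierSpace) (G : Graph) : Set where
  open Graph G
  field
    ident           : V → Fin (IdentifierSpace.size I order)
    ident-injective : Injective _≡_ _≡_ ident
    ordering        : Fin order ↔ V

  upTo : Fin order → List V
  upTo i = take (suc (toℕ i)) (tabulate (Inverse.to ordering))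

  viewAt : ℕ → Fin order → View (IdentifierSpace.size I order)
  viewAt T i = mkView
    (map ident (upTo i))
    (Vec.tabulate λ x → does (any-V? λ u → (ident u Fin.≟ x) ×-dec seen? u))
    (Vec.tabulate λ x → Vec.tabulate λ y → does (any-V? λ u → any-V? λ v →
      (ident u Fin.≟ x) ×-dec (ident v Fin.≟ y) ×-dec seen? u ×-dec seen? v ×-dec Adj? u v))
    where
    seen? : Decidable (Ball G (upTo i) T)
    seen? = Ball? G (upTo i) T

Coloring : Graph → ℕ → Set
Coloring G q = Graph.V G → Fin q

Proper : ∀ G {q} → Coloring G q → Set
Proper G col = ∀ {u v} → Graph.Adj G u v → col u ≢ col v

run : ∀ {I q} → Algorithm I q → ∀ G → Adversary I G → Coloring G q
run A G adv v = output order (viewAt (locality order) (Inverse.from ordering v))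
  where
  open Algorithm A
  open Graph G
  open Adversary adv

ProperlyColors : ∀ {I q} → Algorithm I q → Graph → Set
ProperlyColors {I} A G = (adv : Adversary I G) → Proper G (run A G adv)

module Submission where

-- Orienting the three colours cyclically, each edge of a properly coloured grid is a step ±1,
-- and the steps around every 4-cycle cancel; so the heights (sums of steps) along two parallel
-- row segments at distance d differ by at most 2d. The adversary first has row 0 coloured.
-- In row R = 2T + 2 it presents many stretches of columns whose order and orientation remain
-- undetermined: two stretches on which the height rises by at least k are joined, after
-- choosing the parity of the gap so that the gap does not rise by exactly -k; then either the
-- union rises by at least k + 1, or the gap, read backwards, does. Hence a rise of 4T + 5 is
-- forced on a stretch of length 2 ^ O(T). Placing this stretch forwards or backwards below the
-- same segment of row 0, whose colours are the same in both cases, is a contradiction.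

open import Defs
open import Data.Nat using (ℕ; zero; suc; _+_; _*_; _^_; _≤_; _<_; _≤?_; ∣_-_∣; s≤s; z≤n; s≤s⁻¹)
open import Data.Nat.Logarithm using (⌈log₂_⌉; ⌈log₂⌉-mono-≤; ⌈log₂2^n⌉≡n)
import Data.Nat.Properties as ℕ
import Data.Nat.Tactic.RingSolver as ℕ-Ring
open import Data.Integer using (ℤ; +_; -_; 0ℤ; 1ℤ; -1ℤ) renaming (_≤_ to _≤ℤ_; _+_ to _+ℤ_; _-_ to _-ℤ_)
import Data.Integer as ℤ
import Data.Integer.Properties as ℤ
import Data.Integer.Tactic.RingSolver as ℤ-Ring
open import Data.Rational using (0ℚ; _/_; toℚᵘ) renaming (_*_ to _*ℚ_; _≤_ to _≤ℚ_; _<_ to _<ℚ_)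
import Data.Rational.Properties as ℚ
open import Data.Rational.Unnormalised using (mkℚᵘ; *≤*) renaming (_*_ to _*ᵘ_)
import Data.Rational.Unnormalised.Properties as ℚᵘ
open import Data.Fin using (Fin; toℕ; fromℕ<; combine; remQuot; inject≤)
import Data.Fin as Fin
import Data.Fin.Properties as Fin
open import Data.Fin.Patterns
open import Data.Fin.Permutation
  using (Permutation′; _⟨$⟩ʳ_; _⟨$⟩ˡ_; _∘ₚ_; transpose; inverseˡ; inverseʳ)
import Data.Fin.Permutation as Perm
import Data.Fin.Permutation.Components as PC
open import Data.List
  using (List; []; _∷_; [_]; _++_; _ʳ++_; reverse; map; length; concat; take; tabulate; allFin)
import Data.List.Properties as List
open import Data.List.Membership.Propositional using (_∈_)
open import Data.List.Membership.Propositional.Properties using (∈-++⁺ˡ; ∈-++⁺ʳ)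
open import Data.List.Relation.Binary.Permutation.Propositional
  using (_↭_; ↭-refl; ↭-sym; ↭-trans; ↭-reflexive; ↭⇒↭ₛ)
open import Data.List.Relation.Binary.Permutation.Propositional.Properties
  using (++⁺; ↭-reverse; ↭-length; All-resp-↭; ∈-resp-↭; ++↭ʳ++; ++-commutativeMonoid)
import Data.List.Relation.Binary.Permutation.Setoid.Properties as ↭ₛ
open import Data.List.Relation.Unary.All using (All; []; _∷_)
import Data.List.Relation.Unary.All as All
import Data.List.Relation.Unary.All.Properties as All
open import Data.List.Relation.Unary.AllPairs using ([]; _∷_)
open import Data.List.Relation.Unary.Any using (Any; here; there)
open import Data.List.Relation.Unary.Linked as Linked using (Linked; []; [-]; _∷_)
import Data.List.Relation.Unary.Linked.Properties as Linked
open import Data.List.Relation.Unary.Unique.Propositional using (Unique)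
import Data.List.Relation.Unary.Unique.Propositional.Properties as Unique
open import Data.Product using (∃-syntax; Σ-syntax; _×_; _,_; proj₁; proj₂)
open import Data.Sum using (_⊎_; inj₁; inj₂; [_,_]′)
open import Data.Empty using (⊥)
open import Data.Unit using (⊤; tt)
import Data.Vec.Properties as Vec
open import Function using (_∘_; mk⇔)
open import Function.Bundles using (Injection; mk↔ₛ′)
open import Function.Properties.Inverse using (↔⇒↣)
open import Level using (0ℓ)
open import Relation.Binary using (Rel; Symmetric; tri<; tri≈; tri>)
open import Relation.Binary.PropositionalEquality hiding ([_])
open import Relation.Nullary using (Dec; yes; no; ¬_; contradiction)
open import Relation.Nullary.Decidable
  using (dec-true; dec-false; toSum; from-yes; does-⇔; _×-dec_; _→-dec_; ¬?)

-- An adaptive adversary postpones decisions, whereas `ProperlyColors` speaks of complete inputs.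
-- Each stage is therefore a set of constraints on complete inputs (layouts): which columns must be
-- consecutive, and in which order columns of row `R` are presented. A colour is determined once all
-- layouts meeting the constraints yield the same view, and a rise is bounded for all of them at
-- once. Identifiers travel with the columns, so a view can reveal the place of a stretch only
-- through its ends or through row 0. Hence presented columns lie more than `T` away from the ends
-- of their stretch. Rows 0 and `R` see rows up to `T` and from `R - T` on; `R = 2T + 2` is the
-- least value for which row `T + 1` separates these zones, so that no revealed edge joins them. The
-- target `4T + 5` is `2R + 1`: the forward and the backward placement differ in rise by at least
-- twice the target, while comparison with the same segment of row 0 allows at most `4R`.

-- Heights along properly 3-coloured paths.

δ : Fin 3 → Fin 3 → ℤ
δ 0F 1F = 1ℤ
δ 1F 2F = 1ℤ
δ 2F 0F = 1ℤ
δ 1F 0F = -1ℤ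
δ 2F 1F = -1ℤ
δ 0F 2F = -1ℤ
δ 0F 0F = 0ℤ
δ 1F 1F = 0ℤ
δ 2F 2F = 0ℤ

δ-antisym : ∀ a b → δ b a ≡ - δ a b
δ-antisym = from-yes (Fin.all? λ a → Fin.all? λ b → δ b a ℤ.≟ - δ a b)

δ-unit : ∀ a b → a ≢ b → δ a b ≡ 1ℤ ⊎ δ a b ≡ -1ℤ
δ-unit 0F 0F a≢b = contradiction refl a≢b
δ-unit 0F 1F _ = inj₁ refl
δ-unit 0F 2F _ = inj₂ refl
δ-unit 1F 0F _ = inj₂ refl
δ-unit 1F 1F a≢b = contradiction refl a≢b
δ-unit 1F 2F _ = inj₁ refl
δ-unit 2F 0F _ = inj₁ refl
δ-unit 2F 1F _ = inj₂ refl
δ-unit 2F 2F a≢b = contradiction refl a≢b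

δ≤1 : ∀ a b → δ a b ≤ℤ 1ℤ
δ≤1 = from-yes (Fin.all? λ a → Fin.all? λ b → δ a b ℤ.≤? 1ℤ)

-- The sum of the steps around a 4-cycle is a multiple of 3, even, and at most 4 in absolute value.
δ-square : ∀ a b c d → a ≢ b → a ≢ c → b ≢ d → c ≢ d → δ a b +ℤ δ b d ≡ δ a c +ℤ δ c d
δ-square = from-yes (Fin.all? λ a → Fin.all? λ b → Fin.all? λ c → Fin.all? λ d →
  ¬? (a Fin.≟ b) →-dec ¬? (a Fin.≟ c) →-dec ¬? (b Fin.≟ d) →-dec ¬? (c Fin.≟ d) →-dec
  (δ a b +ℤ δ b d ℤ.≟ δ a c +ℤ δ c d))

rise : List (Fin 3) → ℤ
rise []          = 0ℤ
rise (_ ∷ [])    = 0ℤ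
rise (a ∷ b ∷ l) = δ a b +ℤ rise (b ∷ l)

rise-++ : ∀ xs a ys → rise (xs ++ a ∷ ys) ≡ rise (xs ++ [ a ]) +ℤ rise (a ∷ ys)
rise-++ []           a ys = sym (ℤ.+-identityˡ _)
rise-++ (x ∷ [])     a ys = cong (_+ℤ rise (a ∷ ys)) (sym (ℤ.+-identityʳ (δ x a)))
rise-++ (x ∷ y ∷ xs) a ys =
  trans (cong (λ z → δ x y +ℤ z) (rise-++ (y ∷ xs) a ys)) (sym (ℤ.+-assoc (δ x y) _ _))

rise-ʳ++ : ∀ xs a ys → rise (xs ʳ++ a ∷ ys) ≡ rise (a ∷ ys) -ℤ rise (a ∷ xs)
rise-ʳ++ []       a ys = sym (ℤ.+-identityʳ _)
rise-ʳ++ (b ∷ xs) a ys = begin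
  rise (xs ʳ++ b ∷ a ∷ ys)                 ≡⟨ rise-ʳ++ xs b (a ∷ ys) ⟩
  δ b a +ℤ rise (a ∷ ys) -ℤ rise (b ∷ xs)
    ≡⟨ cong (λ z → z +ℤ rise (a ∷ ys) -ℤ rise (b ∷ xs)) (δ-antisym a b) ⟩
  - δ a b +ℤ rise (a ∷ ys) -ℤ rise (b ∷ xs)  ≡⟨ lemma (δ a b) (rise (a ∷ ys)) (rise (b ∷ xs)) ⟩
  rise (a ∷ ys) -ℤ (δ a b +ℤ rise (b ∷ xs))  ∎
  where
  open ≡-Reasoning
  lemma : ∀ x y z → - x +ℤ y -ℤ z ≡ y -ℤ (x +ℤ z)
  lemma = ℤ-Ring.solve-∀

rise-reverse : ∀ xs → rise (reverse xs) ≡ - rise xs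
rise-reverse []       = refl
rise-reverse (a ∷ xs) = trans (rise-ʳ++ xs a []) (ℤ.+-identityˡ _)

-- The witness `j` counts the steps `-1`; thus the rise has the parity of the number of edges.
rise-parity : ∀ {a l} → Linked _≢_ (a ∷ l) → ∃[ j ] rise (a ∷ l) +ℤ + (2 * j) ≡ + length l
rise-parity [-] = 0 , refl
rise-parity {a} {b ∷ l} (a≢b ∷ ls) with rise-parity ls | δ-unit a b a≢b
... | j , eq | inj₁ δ≡1 = j , (begin
  δ a b +ℤ rise (b ∷ l) +ℤ + (2 * j)    ≡⟨ cong (λ z → z +ℤ rise (b ∷ l) +ℤ + (2 * j)) δ≡1 ⟩
  1ℤ +ℤ rise (b ∷ l) +ℤ + (2 * j)       ≡⟨ ℤ.+-assoc 1ℤ (rise (b ∷ l)) _ ⟩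
  1ℤ +ℤ (rise (b ∷ l) +ℤ + (2 * j))     ≡⟨ cong (λ z → 1ℤ +ℤ z) eq ⟩
  + suc (length l)                     ∎)
  where open ≡-Reasoning
... | j , eq | inj₂ δ≡-1 = suc j , (begin
  δ a b +ℤ rise (b ∷ l) +ℤ + (2 * suc j)
    ≡⟨ cong₂ (λ y z → y +ℤ rise (b ∷ l) +ℤ z) δ≡-1 (cong +_ (ℕ.*-suc 2 j)) ⟩
  -1ℤ +ℤ rise (b ∷ l) +ℤ (+ 2 +ℤ + (2 * j)) ≡⟨ lemma (rise (b ∷ l)) (+ (2 * j)) ⟩
  1ℤ +ℤ (rise (b ∷ l) +ℤ + (2 * j))     ≡⟨ cong (λ z → 1ℤ +ℤ z) eq ⟩
  + suc (length l)                       ∎)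
  where
  open ≡-Reasoning
  lemma : ∀ x y → -1ℤ +ℤ x +ℤ (+ 2 +ℤ y) ≡ 1ℤ +ℤ (x +ℤ y)
  lemma = ℤ-Ring.solve-∀

rise≢ : ∀ {a l} k → Linked _≢_ (a ∷ l) → (∀ j → length l + k ≢ 2 * j) → rise (a ∷ l) ≢ - + k
rise≢ {a} {l} k lk odd eq with rise-parity lk
... | j , par = odd j (ℤ.+-injective (begin
  + length l +ℤ + k                    ≡⟨ cong (λ z → z +ℤ + k) par ⟨
  rise (a ∷ l) +ℤ + (2 * j) +ℤ + k     ≡⟨ cong (λ z → z +ℤ + (2 * j) +ℤ + k) eq ⟩
  - + k +ℤ + (2 * j) +ℤ + k            ≡⟨ lemma (+ k) (+ (2 * j)) ⟩
  + (2 * j)                          ∎))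
  where
  open ≡-Reasoning
  lemma : ∀ x y → - x +ℤ y +ℤ x ≡ y
  lemma = ℤ-Ring.solve-∀

even⊎odd : ∀ n → (∃[ j ] n ≡ 2 * j) ⊎ (∃[ j ] n ≡ suc (2 * j))
even⊎odd zero = inj₁ (0 , refl)
even⊎odd (suc n) with even⊎odd n
... | inj₁ (j , eq) = inj₂ (j , cong suc eq)
... | inj₂ (j , eq) = inj₁ (suc j , trans (cong suc eq) (sym (ℕ.*-suc 2 j)))

-- For `x = z = k` the value `y = - k` is the only one at which both alternatives fail; any larger
-- `y` leaves the sum at least one above `k`, any smaller one makes `- y` exceed `k`.
join-rise : ∀ k {x y z} → + k ≤ℤ x → + k ≤ℤ z → y ≢ - + k →
  (+ suc k ≤ℤ x +ℤ (y +ℤ z)) ⊎ (+ suc k ≤ℤ - y)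
join-rise k {x} {y} {z} k≤x k≤z y≢ with ℤ.<-cmp y (- + k)
... | tri≈ _ eq _ = contradiction eq y≢
... | tri< y< _ _ = inj₂ (subst₂ _≤ℤ_ (cong (λ z → 1ℤ +ℤ z) (ℤ.neg-involutive (+ k))) refl
                      (ℤ.i<j⇒suc[i]≤j (ℤ.neg-mono-< y<)))
... | tri> _ _ >y = inj₁ (subst (_≤ℤ x +ℤ (y +ℤ z)) (lemma (+ k))
                      (ℤ.+-mono-≤ k≤x (ℤ.+-mono-≤ (ℤ.i<j⇒suc[i]≤j >y) k≤z)))
  where
  lemma : ∀ k → k +ℤ (1ℤ +ℤ - k +ℤ k) ≡ 1ℤ +ℤ k
  lemma = ℤ-Ring.solve-∀

-- By `δ-square` the crossing steps telescope: the two rises differ exactly by one crossing step at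
-- each end, and each of these is at most 1.
rise-parallel : ∀ {A : Set} (f g : A → Fin 3) {p path} →
  Linked (λ a b → f a ≢ f b × g a ≢ g b × f a ≢ g a × f b ≢ g b) (p ∷ path) →
  rise (map f (p ∷ path)) ≤ℤ rise (map g (p ∷ path)) +ℤ + 2
rise-parallel {A} f g {p} {path} lk = let q , eq = telescope lk in
  subst (_≤ℤ _) (sym eq) (ℤ.+-monoʳ-≤ (rise (map g (p ∷ path))) (ℤ.+-mono-≤ (δ≤1 (f p) (g p)) (δ≤1 (g q) (f q))))
  where
  telescope : ∀ {p path} → Linked (λ a b → f a ≢ f b × g a ≢ g b × f a ≢ g a × f b ≢ g b) (p ∷ path) →
    ∃[ q ] rise (map f (p ∷ path)) ≡ rise (map g (p ∷ path)) +ℤ (δ (f p) (g p) +ℤ δ (g q) (f q))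
  telescope {p} [-] = p , sym (trans (ℤ.+-identityˡ _)
    (trans (cong (λ z → δ (f p) (g p) +ℤ z) (δ-antisym (f p) (g p))) (ℤ.+-inverseʳ (δ (f p) (g p)))))
  telescope {a} {b ∷ path} ((fab , gab , fga , fgb) ∷ lk) with telescope lk
  ... | q , eq = q , (begin
    δ (f a) (f b) +ℤ rise (map f (b ∷ path))
      ≡⟨ cong (λ z → δ (f a) (f b) +ℤ z) eq ⟩
    δ (f a) (f b) +ℤ (r +ℤ (δ (f b) (g b) +ℤ e))
      ≡⟨ lemma₁ (δ (f a) (f b)) r (δ (f b) (g b)) e ⟩
    (δ (f a) (f b) +ℤ δ (f b) (g b)) +ℤ (r +ℤ e)
      ≡⟨ cong (_+ℤ (r +ℤ e)) (δ-square (f a) (f b) (g a) (g b) fab fga fgb gab) ⟩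
    (δ (f a) (g a) +ℤ δ (g a) (g b)) +ℤ (r +ℤ e)
      ≡⟨ lemma₂ (δ (f a) (g a)) (δ (g a) (g b)) r e ⟩
    (δ (g a) (g b) +ℤ r) +ℤ (δ (f a) (g a) +ℤ e) ∎)
    where
    open ≡-Reasoning
    r e : ℤ
    r = rise (map g (b ∷ path))
    e = δ (g q) (f q)
    lemma₁ : ∀ x y z w → x +ℤ (y +ℤ (z +ℤ w)) ≡ (x +ℤ z) +ℤ (y +ℤ w)
    lemma₁ = ℤ-Ring.solve-∀
    lemma₂ : ∀ x y z w → (x +ℤ y) +ℤ (z +ℤ w) ≡ (y +ℤ z) +ℤ (x +ℤ w)
    lemma₂ = ℤ-Ring.solve-∀

-- Paths, consecutive positions and permutations.

module _ {A : Set} {R : Rel A 0ℓ} where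

  Linked-++⁻ˡ : ∀ xs {ys} → Linked R (xs ++ ys) → Linked R xs
  Linked-++⁻ˡ []           _       = []
  Linked-++⁻ˡ (x ∷ [])     _       = [-]
  Linked-++⁻ˡ (x ∷ y ∷ xs) (r ∷ l) = r ∷ Linked-++⁻ˡ (y ∷ xs) l

  Linked-++⁻ʳ : ∀ xs {ys} → Linked R (xs ++ ys) → Linked R ys
  Linked-++⁻ʳ []       l = l
  Linked-++⁻ʳ (x ∷ xs) l = Linked-++⁻ʳ xs (Linked.tail l)

  Linked-ʳ++⁻ : ∀ xs {ys} → Linked R (xs ʳ++ ys) → Linked R ys
  Linked-ʳ++⁻ []       l = l
  Linked-ʳ++⁻ (x ∷ xs) l = Linked.tail (Linked-ʳ++⁻ xs l)

  Linked-reverse : Symmetric R → ∀ {xs} → Linked R xs → Linked R (reverse xs)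
  Linked-reverse sym-R {[]}     _ = []
  Linked-reverse sym-R {x ∷ xs} l = go l [-]
    where
    go : ∀ {x xs ys} → Linked R (x ∷ xs) → Linked R (x ∷ ys) → Linked R (xs ʳ++ x ∷ ys)
    go [-]     l′ = l′
    go (r ∷ l) l′ = go l (sym-R r ∷ l′)

Unique-resp-↭ : ∀ {A : Set} {xs ys : List A} → xs ↭ ys → Unique xs → Unique ys
Unique-resp-↭ {A} p = ↭ₛ.Unique-resp-↭ (setoid A) (↭⇒↭ₛ p)

Unique-++⁻ʳ : ∀ {A : Set} xs {ys : List A} → Unique (xs ++ ys) → Unique ys
Unique-++⁻ʳ []       u       = u
Unique-++⁻ʳ (x ∷ xs) (_ ∷ u) = Unique-++⁻ʳ xs u

Unique-++⁻ˡ : ∀ {A : Set} xs {ys : List A} → Unique (xs ++ ys) → Unique xs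
Unique-++⁻ˡ []       u       = []
Unique-++⁻ˡ (x ∷ xs) (p ∷ u) = All.++⁻ˡ xs p ∷ Unique-++⁻ˡ xs u

module _ {m : ℕ} where

  injective : ∀ (σ : Permutation′ m) {i j} → σ ⟨$⟩ʳ i ≡ σ ⟨$⟩ʳ j → i ≡ j
  injective σ = Injection.injective (↔⇒↣ σ)

  transpose-first : ∀ (i j : Fin m) → PC.transpose i j i ≡ j
  transpose-first i j rewrite dec-true (i Fin.≟ i) refl = refl

  transpose-second : ∀ (i j : Fin m) → PC.transpose i j j ≡ i
  transpose-second i j with j Fin.≟ i
  ... | yes j≡i = j≡i
  ... | no  _ rewrite dec-true (j Fin.≟ j) refl = refl

  transpose-other : ∀ (i j : Fin m) {k} → k ≢ i → k ≢ j → PC.transpose i j k ≡ k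
  transpose-other i j {k} k≢i k≢j
    rewrite dec-false (k Fin.≟ i) k≢i | dec-false (k Fin.≟ j) k≢j = refl

  Near : (Fin m → Fin m) → Rel (Fin m) 0ℓ
  Near f a b = ∣ toℕ (f a) - toℕ (f b) ∣ ≡ 1

  -- Serves both for positions within a row (`f` from `pos`) and for times of presentation (`f` from
  -- `ord`).
  At : (Fin m → Fin m) → ℕ → List (Fin m) → Set
  At f n []       = ⊤
  At f n (c ∷ cs) = toℕ (f c) ≡ n × At f (suc n) cs

  At-++⁻ˡ : ∀ {f n} xs {ys} → At f n (xs ++ ys) → At f n xs
  At-++⁻ˡ []       _        = tt
  At-++⁻ˡ (x ∷ xs) (e , at) = e , At-++⁻ˡ xs at

  At-++⁻ʳ : ∀ {f n} xs {ys} → At f n (xs ++ ys) → At f (length xs + n) ys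
  At-++⁻ʳ         []       at       = at
  At-++⁻ʳ {f} {n} (x ∷ xs) {ys} (_ , at) =
    subst (λ n → At f n ys) (ℕ.+-suc (length xs) n) (At-++⁻ʳ xs at)

  At⇒Linked : ∀ {f n} xs → At f n xs → Linked (Near f) xs
  At⇒Linked []           _             = []
  At⇒Linked (x ∷ [])     _             = [-]
  At⇒Linked {f} {n} (x ∷ y ∷ xs) (e , e′ , at) = near ∷ At⇒Linked (y ∷ xs) (e′ , at)
    where
    near : Near f x y
    near = trans (cong₂ ∣_-_∣ e e′) (trans (cong ∣ n -_∣ (sym (ℕ.+-comm n 1))) (ℕ.∣m-m+n∣≡n n 1))

  At-unique : ∀ {f g n} xs ys → length xs ≡ length ys → At f n xs → At g n ys → map f xs ≡ map g ys
  At-unique []       []       _  _        _         = refl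
  At-unique (x ∷ xs) (y ∷ ys) eq (e , at) (e′ , at′) =
    cong₂ _∷_ (Fin.toℕ-injective (trans e (sym e′))) (At-unique xs ys (ℕ.suc-injective eq) at at′)

  At-agree : ∀ {f g n c xs} → At f n xs → At g n xs → c ∈ xs → f c ≡ g c
  At-agree (e , _)  (e′ , _)   (here refl) = Fin.toℕ-injective (trans e (sym e′))
  At-agree (_ , at) (_ , at′) (there c∈)  = At-agree at at′ c∈

  At-bound : ∀ {f n c xs} → At f n xs → c ∈ xs → n ≤ toℕ (f c) × toℕ (f c) < n + length xs
  At-bound {n = n} {xs = x ∷ xs} (e , at) (here refl) =
    ℕ.≤-reflexive (sym e) , ℕ.≤-<-trans (ℕ.≤-reflexive e) (ℕ.m<m+n n (s≤s z≤n))
  At-bound {f} {n} {c} {x ∷ xs} (e , at) (there c∈) with At-bound at c∈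
  ... | lo , hi = ℕ.<⇒≤ lo , subst (toℕ (f c) <_) (sym (ℕ.+-suc n (length xs))) hi

  At-index : ∀ {f g n t} xs → At f n xs → At g n xs → n ≤ t → t < n + length xs →
    ∃[ c ] (c ∈ xs × toℕ (f c) ≡ t × toℕ (g c) ≡ t)
  At-index {n = n} {t} [] _ _ lo hi = contradiction (subst (t <_) (ℕ.+-identityʳ n) hi) (ℕ.≤⇒≯ lo)
  At-index {n = n} {t} (x ∷ xs) (e , at) (e′ , at′) lo hi with n ℕ.≟ t
  ... | yes refl = x , here refl , e , e′
  ... | no n≢t with At-index xs at at′ (ℕ.≤∧≢⇒< lo n≢t) (subst (t <_) (ℕ.+-suc n (length xs)) hi)
  ... | c , c∈ , p , q = c , there c∈ , p , q

  -- Built from one transposition per entry: the value `n` is swapped onto the head, and the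
  -- recursion continues at `suc n`. Since all entries have values at least `n`, no swap disturbs a
  -- value below `n`, where earlier entries already sit.
  arrange : ∀ n xs (σ : Permutation′ m) → Unique xs → All (λ c → n ≤ toℕ (σ ⟨$⟩ʳ c)) xs →
    ∃[ σ′ ] (At (σ′ ⟨$⟩ʳ_) n xs × (∀ c → toℕ (σ ⟨$⟩ʳ c) < n → σ′ ⟨$⟩ʳ c ≡ σ ⟨$⟩ʳ c))
  arrange n []       σ _         _         = σ , tt , λ _ _ → refl
  arrange n (x ∷ xs) σ (x∉ ∷ u) (n≤x ∷ n≤) = result
    where
    n<m : n < m
    n<m = ℕ.≤-<-trans n≤x (Fin.toℕ<n _)
    k : Fin m
    k = fromℕ< n<m
    toℕ-k : toℕ k ≡ n
    toℕ-k = Fin.toℕ-fromℕ< n<m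
    σ₁ : Permutation′ m
    σ₁ = σ ∘ₚ transpose k (σ ⟨$⟩ʳ x)
    σ₁x : σ₁ ⟨$⟩ʳ x ≡ k
    σ₁x = transpose-second k (σ ⟨$⟩ʳ x)
    below : ∀ c → toℕ (σ ⟨$⟩ʳ c) < n → σ₁ ⟨$⟩ʳ c ≡ σ ⟨$⟩ʳ c
    below c lt = transpose-other k (σ ⟨$⟩ʳ x)
      (λ eq → ℕ.<-irrefl (trans (cong toℕ eq) toℕ-k) lt)
      (λ eq → ℕ.<⇒≱ lt (subst (λ z → n ≤ toℕ z) (sym eq) n≤x))
    above : ∀ {c} → x ≢ c → n ≤ toℕ (σ ⟨$⟩ʳ c) → suc n ≤ toℕ (σ₁ ⟨$⟩ʳ c)
    above {c} x≢c le = ℕ.≤∧≢⇒< n≤σ₁c λ eq →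
      x≢c (injective σ₁ (trans σ₁x (Fin.toℕ-injective (trans toℕ-k eq))))
      where
      n≤σ₁c : n ≤ toℕ (σ₁ ⟨$⟩ʳ c)
      n≤σ₁c = [ (λ eq → subst (λ z → n ≤ toℕ z)
                   (sym (trans (cong (PC.transpose k (σ ⟨$⟩ʳ x)) eq) (transpose-first k (σ ⟨$⟩ʳ x)))) n≤x)
              , (λ ≢k → subst (λ z → n ≤ toℕ z)
                   (sym (transpose-other k (σ ⟨$⟩ʳ x) ≢k λ eq → x≢c (sym (injective σ eq)))) le)
              ]′ (toSum (σ ⟨$⟩ʳ c Fin.≟ k))
    result : ∃[ σ′ ] (At (σ′ ⟨$⟩ʳ_) n (x ∷ xs) × (∀ c → toℕ (σ ⟨$⟩ʳ c) < n → σ′ ⟨$⟩ʳ c ≡ σ ⟨$⟩ʳ c))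
    result with arrange (suc n) xs σ₁ u (All.zipWith (λ (p , q) → above p q) (x∉ , n≤))
    ... | σ′ , at , agree = σ′ ,
      (trans (cong toℕ (trans (agree x (s≤s (ℕ.≤-reflexive (trans (cong toℕ σ₁x) toℕ-k)))) σ₁x)) toℕ-k , at) ,
      λ c lt → trans (agree c (subst (λ z → toℕ z < suc n) (sym (below c lt)) (ℕ.m<n⇒m<1+n lt))) (below c lt)

∣n-a∣≡1 : ∀ n a → ∣ n - a ∣ ≡ 1 → a ≡ suc n ⊎ n ≡ suc a
∣n-a∣≡1 zero    a             e    = inj₁ e
∣n-a∣≡1 (suc n) zero          e    = inj₂ e
∣n-a∣≡1 (suc n) (suc a)       e    with ∣n-a∣≡1 n a e
... | inj₁ eq = inj₁ (cong suc eq)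
... | inj₂ eq = inj₂ (cong suc eq)

two-neighbours : ∀ {n a b c} → ∣ n - a ∣ ≡ 1 → ∣ n - b ∣ ≡ 1 → a ≢ b → ∣ n - c ∣ ≡ 1 → c ≡ a ⊎ c ≡ b
two-neighbours {n} {a} {b} {c} na nb a≢b nc
  with ∣n-a∣≡1 n a na | ∣n-a∣≡1 n b nb | ∣n-a∣≡1 n c nc
... | inj₁ p    | inj₁ q    | _      = contradiction (trans p (sym q)) a≢b
... | inj₂ p    | inj₂ q    | _      = contradiction (ℕ.suc-injective (trans (sym p) q)) a≢b
... | inj₁ p    | inj₂ _    | inj₁ r = inj₁ (trans r (sym p))
... | inj₁ _    | inj₂ q    | inj₂ r = inj₂ (ℕ.suc-injective (trans (sym r) q))
... | inj₂ _    | inj₁ q    | inj₁ r = inj₂ (trans r (sym q))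
... | inj₂ p    | inj₁ _    | inj₂ r = inj₁ (ℕ.suc-injective (trans (sym r) p))

sum≡1 : ∀ a b → a + b ≡ 1 → (a ≡ 0 × b ≡ 1) ⊎ (a ≡ 1 × b ≡ 0)
sum≡1 zero          b    e = inj₁ (refl , e)
sum≡1 (suc zero)    zero e = inj₂ (refl , refl)

module _ {A : Set} where

  Any-take-tabulate⁻ : ∀ {P : A → Set} {n} k (f : Fin n → A) →
    Any P (take k (tabulate f)) → ∃[ i ] (toℕ i < k × P (f i))
  Any-take-tabulate⁻ {n = suc n} (suc k) f (here p)  = Fin.zero , s≤s z≤n , p
  Any-take-tabulate⁻ {n = suc n} (suc k) f (there p) with Any-take-tabulate⁻ k (f ∘ Fin.suc) p
  ... | i , lt , q = Fin.suc i , s≤s lt , q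
  Any-take-tabulate⁻ {n = zero} zero f ()
  Any-take-tabulate⁻ {n = zero} (suc k) f ()
  Any-take-tabulate⁻ {n = suc n} zero f ()

  Any-take-tabulate⁺ : ∀ {P : A → Set} {n} k (f : Fin n → A) i → toℕ i < k → P (f i) →
    Any P (take k (tabulate f))
  Any-take-tabulate⁺ (suc k) f Fin.zero    _        p = here p
  Any-take-tabulate⁺ (suc k) f (Fin.suc i) (s≤s lt) p =
    there (Any-take-tabulate⁺ k (f ∘ Fin.suc) i lt p)

  map-take-tabulate : ∀ {B : Set} {n} k (h h′ : A → B) (f f′ : Fin n → A) →
    (∀ i → toℕ i < k → h (f i) ≡ h′ (f′ i)) →
    map h (take k (tabulate f)) ≡ map h′ (take k (tabulate f′))
  map-take-tabulate {n = zero}  zero    h h′ f f′ eq = refl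
  map-take-tabulate {n = zero}  (suc k) h h′ f f′ eq = refl
  map-take-tabulate {n = suc n} zero    h h′ f f′ eq = refl
  map-take-tabulate {n = suc n} (suc k) h h′ f f′ eq = cong₂ _∷_ (eq Fin.zero (s≤s z≤n))
    (map-take-tabulate k h h′ (f ∘ Fin.suc) (f′ ∘ Fin.suc) λ i lt → eq (Fin.suc i) (s≤s lt))

-- Columns whose surroundings are the same in all fitting layouts.

module _ {m : ℕ} where

  Fits : List (List (Fin m)) → Permutation′ m → Set
  Fits css π = All (Linked (Near (π ⟨$⟩ʳ_))) css

  Forced : List (List (Fin m)) → Fin m → Fin m → Set
  Forced css a b = ∀ π → Fits css π → Near (π ⟨$⟩ʳ_) a b

  -- Around a deep column c, all layouts that fit css contain the same path, up to reflection:
  -- a column near c in one of them is one of the two forced neighbours, hence near c in all.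
  Deep : List (List (Fin m)) → ℕ → Fin m → Set
  Deep css zero    c = ∃[ a ] ∃[ b ] (a ≢ b × Forced css c a × Forced css c b)
  Deep css (suc t) c =
    ∃[ a ] ∃[ b ] (a ≢ b × Forced css c a × Forced css c b × Deep css t a × Deep css t b)

  Deep-mono : ∀ {css css′} → (∀ π → Fits css′ π → Fits css π) → ∀ t {c} → Deep css t c → Deep css′ t c
  Deep-mono fits zero    (a , b , a≢b , Fa , Fb) =
    a , b , a≢b , (λ π → Fa π ∘ fits π) , (λ π → Fb π ∘ fits π)
  Deep-mono fits (suc t) (a , b , a≢b , Fa , Fb , Da , Db) =
    a , b , a≢b , (λ π → Fa π ∘ fits π) , (λ π → Fb π ∘ fits π) , Deep-mono fits t Da , Deep-mono fits t Db

  Deep-pred : ∀ {css} t {c} → Deep css (suc t) c → Deep css t c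
  Deep-pred zero    (a , b , a≢b , Fa , Fb , _)       = a , b , a≢b , Fa , Fb
  Deep-pred (suc t) (a , b , a≢b , Fa , Fb , Da , Db) =
    a , b , a≢b , Fa , Fb , Deep-pred t Da , Deep-pred t Db

  Deep-zero : ∀ {css} t {c} → Deep css t c → Deep css 0 c
  Deep-zero zero    d = d
  Deep-zero (suc t) d = Deep-zero t (Deep-pred t d)

  module _ {css π} (fits : Fits css π) where

    near-forced : ∀ {a b c d} → a ≢ b → Forced css c a → Forced css c b → Near (π ⟨$⟩ʳ_) c d →
      d ≡ a ⊎ d ≡ b
    near-forced {a} {b} {c} {d} a≢b Fa Fb near
      with two-neighbours {toℕ (π ⟨$⟩ʳ c)} (Fa π fits) (Fb π fits)
             (λ eq → a≢b (injective π (Fin.toℕ-injective eq))) near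
    ... | inj₁ eq = inj₁ (injective π (Fin.toℕ-injective eq))
    ... | inj₂ eq = inj₂ (injective π (Fin.toℕ-injective eq))

    Deep-forced : ∀ {c d} → Deep css 0 c → Near (π ⟨$⟩ʳ_) c d → Forced css c d
    Deep-forced (a , b , a≢b , Fa , Fb) near with near-forced a≢b Fa Fb near
    ... | inj₁ refl = Fa
    ... | inj₂ refl = Fb

    Deep-near : ∀ {t c d} → Deep css (suc t) c → Near (π ⟨$⟩ʳ_) c d → Deep css t d
    Deep-near (a , b , a≢b , Fa , Fb , Da , Db) near with near-forced a≢b Fa Fb near
    ... | inj₁ refl = Da
    ... | inj₂ refl = Db

-- Layouts as adversaries, and equality of their views.

module Layouts (I : IdentifierSpace) (m T : ℕ) (Z R : Fin m) (Z≡0 : toℕ Z ≡ 0) (R≡ : toℕ R ≡ 2 + T + T) where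

  open IdentifierSpace I

  G : Graph
  G = simpleGrid m m

  open Graph G using (V; Adj)

  -- A layout puts column c of the rows below row T at position pos c, identifiers included, and
  -- presents it at time ord c within row R. The rows up to T, which contain all that is seen from
  -- row Z, stay fixed.
  record Layout : Set where
    constructor layout
    field
      pos ord : Permutation′ m

  open Layout public

  -- The decision is an explicit argument, so that `twist-inverse` settles both twists by a single
  -- case distinction.
  column : (r : Fin m) → Dec (toℕ r ≤ T) → (Fin m → Fin m) → Fin m → Fin m
  column r (yes _) π x = x
  column r (no _)  π x = π x

  twist : (Fin m → Fin m) → V → V
  twist π (r , x) = r , column r (toℕ r ≤? T) π x

  twist-upper : ∀ π {r} x → toℕ r ≤ T → twist π (r , x) ≡ (r , x)
  twist-upper π {r} x r≤T with toℕ r ≤? T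
  ... | yes _   = refl
  ... | no r≰T = contradiction r≤T r≰T

  twist-lower : ∀ π {r} x → ¬ toℕ r ≤ T → twist π (r , x) ≡ (r , π x)
  twist-lower π {r} x r≰T with toℕ r ≤? T
  ... | yes r≤T = contradiction r≤T r≰T
  ... | no _    = refl

  twist-inverse : ∀ {π ρ} → (∀ x → π (ρ x) ≡ x) → ∀ v → twist π (twist ρ v) ≡ v
  twist-inverse {π} {ρ} inv (r , x) = cong (r ,_) (lemma (toℕ r ≤? T))
    where
    lemma : ∀ d → column r d π (column r d ρ x) ≡ x
    lemma (yes _) = refl
    lemma (no _)  = inv x

  Z≢R : Z ≢ R
  Z≢R eq with trans (sym Z≡0) (trans (cong toℕ eq) R≡)
  ... | ()

  abstract
    rowOrder : ∃[ σ ] (At (σ ⟨$⟩ʳ_) 0 (Z ∷ R ∷ []))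
    rowOrder =
      let σ , at , _ = arrange 0 (Z ∷ R ∷ []) Perm.id ((Z≢R ∷ []) ∷ [] ∷ []) (z≤n ∷ z≤n ∷ []) in σ , at

  σ : Permutation′ m
  σ = proj₁ rowOrder

  σZ : toℕ (σ ⟨$⟩ʳ Z) ≡ 0
  σZ = proj₁ (proj₂ rowOrder)

  σR : toℕ (σ ⟨$⟩ʳ R) ≡ 1
  σR = proj₁ (proj₂ (proj₂ rowOrder))

  Z≤T : toℕ Z ≤ T
  Z≤T = subst (_≤ T) (sym Z≡0) z≤n

  R≥ : 2 + T + T ≤ toℕ R
  R≥ = ℕ.≤-reflexive (sym R≡)

  lower : ∀ {r : Fin m} → 2 + T ≤ toℕ r → ¬ toℕ r ≤ T
  lower h r≤T = ℕ.<-irrefl refl (ℕ.≤-trans (ℕ.n≤1+n _) (ℕ.≤-trans h r≤T))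

  R-lower : ¬ toℕ R ≤ T
  R-lower = lower (ℕ.≤-trans (ℕ.m≤m+n (2 + T) T) R≥)

  locate unlocate : Layout → V → V
  locate   e = twist (pos e ⟨$⟩ʳ_)
  unlocate e = twist (pos e ⟨$⟩ˡ_)

  locate-unlocate : ∀ e v → locate e (unlocate e v) ≡ v
  locate-unlocate e = twist-inverse λ _ → inverseʳ (pos e)

  unlocate-locate : ∀ e v → unlocate e (locate e v) ≡ v
  unlocate-locate e = twist-inverse λ _ → inverseˡ (pos e)

  label : V → Fin (size (m * m))
  label (r , c) = inject≤ (combine r c) (enough (m * m))

  -- Time is lexicographic: the block of the row under `σ`, then the time inside the row. Row `Z`
  -- fills the first `m` steps from left to right, row `R` the next `m` in the order `ord`. The same
  -- `twist` that moves columns in space reorders them in time.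
  place : Layout → Fin (m * m) → V
  place e i = let r , t = remQuot {m} m i in locate e (twist (ord e ⟨$⟩ˡ_) (σ ⟨$⟩ˡ r , t))

  time : Layout → V → Fin (m * m)
  time e v = let r , t = twist (ord e ⟨$⟩ʳ_) (unlocate e v) in combine (σ ⟨$⟩ʳ r) t

  place-time : ∀ e v → place e (time e v) ≡ v
  place-time e v = begin
    place e (time e v)
      ≡⟨ cong (λ (r , t) → locate e (twist (ord e ⟨$⟩ˡ_) (σ ⟨$⟩ˡ r , t)))
           (Fin.remQuot-combine (σ ⟨$⟩ʳ proj₁ w) (proj₂ w)) ⟩
    locate e (twist (ord e ⟨$⟩ˡ_) (σ ⟨$⟩ˡ (σ ⟨$⟩ʳ proj₁ w) , proj₂ w))
      ≡⟨ cong (λ r → locate e (twist (ord e ⟨$⟩ˡ_) (r , proj₂ w))) (inverseˡ σ) ⟩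
    locate e (twist (ord e ⟨$⟩ˡ_) w)
      ≡⟨ cong (locate e) (twist-inverse (λ _ → inverseˡ (ord e)) (unlocate e v)) ⟩
    locate e (unlocate e v)
      ≡⟨ locate-unlocate e v ⟩
    v ∎
    where
    open ≡-Reasoning
    w : V
    w = twist (ord e ⟨$⟩ʳ_) (unlocate e v)

  time-place : ∀ e i → time e (place e i) ≡ i
  time-place e i = begin
    time e (place e i)
      ≡⟨ cong (λ v → let r , t = twist (ord e ⟨$⟩ʳ_) v in combine (σ ⟨$⟩ʳ r) t) (unlocate-locate e _) ⟩
    (let r , t = twist (ord e ⟨$⟩ʳ_) (twist (ord e ⟨$⟩ˡ_) w) in combine (σ ⟨$⟩ʳ r) t)
      ≡⟨ cong (λ (r , t) → combine (σ ⟨$⟩ʳ r) t) (twist-inverse (λ _ → inverseʳ (ord e)) w) ⟩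
    combine (σ ⟨$⟩ʳ (σ ⟨$⟩ˡ proj₁ (remQuot {m} m i))) (proj₂ w)
      ≡⟨ cong (λ r → combine r (proj₂ w)) (inverseʳ σ) ⟩
    combine (proj₁ (remQuot {m} m i)) (proj₂ w)
      ≡⟨ Fin.combine-remQuot {m} m i ⟩
    i ∎
    where
    open ≡-Reasoning
    w : V
    w = σ ⟨$⟩ˡ proj₁ (remQuot {m} m i) , proj₂ (remQuot {m} m i)

  label-injective : ∀ {v w} → label v ≡ label w → v ≡ w
  label-injective {r , c} {r′ , c′} eq =
    let p , q = Fin.combine-injective r c r′ c′ (Fin.inject≤-injective _ _ _ _ eq) in cong₂ _,_ p q

  adversary : Layout → Adversary I G
  adversary e = record
    { ident           = label ∘ unlocate e
    ; ident-injective = λ {v} {w} eq → trans (sym (locate-unlocate e v))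
        (trans (cong (locate e) (label-injective eq)) (locate-unlocate e w))
    ; ordering        = mk↔ₛ′ (place e) (time e) (place-time e) (time-place e)
    }

  time-R : ∀ e c → time e (R , pos e ⟨$⟩ʳ c) ≡ combine (σ ⟨$⟩ʳ R) (ord e ⟨$⟩ʳ c)
  time-R e c = cong (λ (r , t) → combine (σ ⟨$⟩ʳ r) t) (begin
    twist (ord e ⟨$⟩ʳ_) (unlocate e (R , pos e ⟨$⟩ʳ c))
      ≡⟨ cong (twist (ord e ⟨$⟩ʳ_)) (twist-lower _ _ R-lower) ⟩
    twist (ord e ⟨$⟩ʳ_) (R , pos e ⟨$⟩ˡ (pos e ⟨$⟩ʳ c))
      ≡⟨ cong (λ c → twist (ord e ⟨$⟩ʳ_) (R , c)) (inverseˡ (pos e)) ⟩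
    twist (ord e ⟨$⟩ʳ_) (R , c)                          ≡⟨ twist-lower _ _ R-lower ⟩
    (R , ord e ⟨$⟩ʳ c)                                   ∎)
    where open ≡-Reasoning

  time-Z : ∀ e x → time e (Z , x) ≡ combine (σ ⟨$⟩ʳ Z) x
  time-Z e x = cong (λ (r , t) → combine (σ ⟨$⟩ʳ r) t)
    (trans (cong (twist (ord e ⟨$⟩ʳ_)) (twist-upper _ x Z≤T)) (twist-upper _ x Z≤T))

  place-Z : ∀ e x → place e (combine (σ ⟨$⟩ʳ Z) x) ≡ (Z , x)
  place-Z e x = trans (cong (place e) (sym (time-Z e x))) (place-time e (Z , x))

  place-R : ∀ e c → place e (combine (σ ⟨$⟩ʳ R) (ord e ⟨$⟩ʳ c)) ≡ (R , pos e ⟨$⟩ʳ c)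
  place-R e c = trans (cong (place e) (sym (time-R e c))) (place-time e (R , pos e ⟨$⟩ʳ c))

  Seen : Layout → Fin (m * m) → V → Set
  Seen e i = Ball G (Adversary.upTo (adversary e) i) T

  -- Ensures that all balls seen up to time `i` agree: those around row `Z` lie in the fixed rows,
  -- and those around row `R` are centred at deep columns presented at equal times.
  Settled : List (List (Fin m)) → Fin (m * m) → Layout → Layout → Set
  Settled css i e e′ = ∀ r t → toℕ (combine r t) ≤ toℕ i → r ≡ σ ⟨$⟩ʳ Z ⊎
    (r ≡ σ ⟨$⟩ʳ R × ∃[ c ] (ord e ⟨$⟩ʳ c ≡ t × ord e′ ⟨$⟩ʳ c ≡ t × Deep css T c))

  Settled-sym : ∀ {css i e e′} → Settled css i e e′ → Settled css i e′ e
  Settled-sym s r t le with s r t le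
  ... | inj₁ eq                     = inj₁ eq
  ... | inj₂ (eq , c , p , q , deep) = inj₂ (eq , c , q , p , deep)

  row-step : ∀ {u v : V} → Adj u v → toℕ (proj₁ v) ≤ suc (toℕ (proj₁ u))
  row-step {r , x} {r′ , x′} adj with sum≡1 ∣ toℕ r - toℕ r′ ∣ _ adj
  ... | inj₁ (eq , _) = ℕ.≤-trans (ℕ.≤-reflexive (sym (ℕ.∣m-n∣≡0⇒m≡n eq))) (ℕ.n≤1+n _)
  ... | inj₂ (eq , _) with ∣n-a∣≡1 (toℕ r) (toℕ r′) eq
  ... | inj₁ p = ℕ.≤-reflexive p
  ... | inj₂ p = ℕ.≤-trans (ℕ.n≤1+n _) (ℕ.≤-trans (ℕ.≤-reflexive (sym p)) (ℕ.n≤1+n _))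

  walk-upper : ∀ {t u v} → Dist≤ G t u v → toℕ (proj₁ u) + t ≤ T → toℕ (proj₁ v) ≤ T
  walk-upper {t} here le = ℕ.≤-trans (ℕ.m≤m+n _ t) le
  walk-upper {suc t} {u} (step {w = w} adj d) le = walk-upper d
    (ℕ.≤-trans (ℕ.+-monoˡ-≤ t (row-step {u} {w} adj)) (ℕ.≤-trans (ℕ.≤-reflexive (sym (ℕ.+-suc _ t))) le))

  module Transport {css e e′} (fits : Fits css (pos e)) (fits′ : Fits css (pos e′)) where

    -- Sends a node to the node with the same identifier in the other layout. On the seen zone it
    -- preserves adjacency, although it need not do so elsewhere.
    transport : V → V
    transport = locate e′ ∘ unlocate e

    shift : Fin m → Fin m
    shift x = pos e′ ⟨$⟩ʳ (pos e ⟨$⟩ˡ x)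

    transport-upper : ∀ {v} → toℕ (proj₁ v) ≤ T → transport v ≡ v
    transport-upper {r , x} le = trans (cong (locate e′) (twist-upper _ x le)) (twist-upper _ x le)

    transport-lower : ∀ {v} → 2 + T ≤ toℕ (proj₁ v) → transport v ≡ (proj₁ v , shift (proj₂ v))
    transport-lower {r , x} le =
      trans (cong (locate e′) (twist-lower _ x (lower le))) (twist-lower _ _ (lower le))

    near : ∀ x x′ → ∣ toℕ x - toℕ x′ ∣ ≡ 1 → Near (pos e ⟨$⟩ʳ_) (pos e ⟨$⟩ˡ x) (pos e ⟨$⟩ˡ x′)
    near x x′ eq =
      subst₂ (λ a b → ∣ toℕ a - toℕ b ∣ ≡ 1) (sym (inverseʳ (pos e))) (sym (inverseʳ (pos e))) eq

    adj-lower : ∀ {r x r′ x′} → Deep css 0 (pos e ⟨$⟩ˡ x) → Adj (r , x) (r′ , x′) →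
      Adj (r , shift x) (r′ , shift x′)
    adj-lower {r} {x} {r′} {x′} deep adj with sum≡1 ∣ toℕ r - toℕ r′ ∣ _ adj
    ... | inj₁ (p , q) = cong₂ _+_ p (Deep-forced {π = pos e} fits deep (near x x′ q) (pos e′) fits′)
    ... | inj₂ (p , q) with Fin.toℕ-injective {i = x} {j = x′} (ℕ.∣m-n∣≡0⇒m≡n q)
    ... | refl = cong₂ _+_ p (ℕ.∣n-n∣≡0 (toℕ (shift x)))

    Lower : V → Set
    Lower (r , x) = 2 + T ≤ toℕ r × Deep css 0 (pos e ⟨$⟩ˡ x)

    -- The invariant with `t` steps left: a step loses at most one row towards row `Z` and at most
    -- one unit of depth. Starting from row `R` at depth `T`, the walk stays below row `T + 1` among
    -- columns with forced neighbours.
    walk-lower : ∀ {t r x v} → Dist≤ G t (r , x) v → 2 + T + t ≤ toℕ r → Deep css t (pos e ⟨$⟩ˡ x) →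
      Dist≤ G t (r , shift x) (proj₁ v , shift (proj₂ v)) × Lower v
    walk-lower {t} here le deep = here , ℕ.≤-trans (ℕ.m≤m+n (2 + T) t) le , Deep-zero t deep
    walk-lower {suc t} {r} {x} (step {w = r′ , x′} adj d) le deep =
      let d′ , low = walk-lower d le′ deep′ in
      step (adj-lower {r} {x} {r′} {x′} (Deep-zero (suc t) deep) adj) d′ , low
      where
      le′ : 2 + T + t ≤ toℕ r′
      le′ = s≤s⁻¹ (ℕ.≤-trans (ℕ.≤-reflexive (sym (ℕ.+-suc (2 + T) t)))
              (ℕ.≤-trans le (row-step {r′ , x′} {r , x} (Graph.Adj-sym G {r , x} {r′ , x′} adj))))
      deep′ : Deep css t (pos e ⟨$⟩ˡ x′)
      deep′ with sum≡1 ∣ toℕ r - toℕ r′ ∣ _ adj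
      ... | inj₁ (_ , q) = Deep-near {π = pos e} fits deep (near x x′ q)
      ... | inj₂ (_ , q) with Fin.toℕ-injective {i = x} {j = x′} (ℕ.∣m-n∣≡0⇒m≡n q)
      ... | refl = Deep-pred t deep

    Upper : V → Set
    Upper (r , _) = toℕ r ≤ T

    -- The mixed cases are void because row `T + 1` lies between the zones; the lower zone can thus
    -- move against the upper one unnoticed.
    adj-transport : ∀ {u v} → Upper u ⊎ Lower u → Upper v ⊎ Lower v → Adj u v →
      Adj (transport u) (transport v)
    adj-transport {u} {v} (inj₁ p) (inj₁ q) adj =
      subst₂ Adj (sym (transport-upper {u} p)) (sym (transport-upper {v} q)) adj
    adj-transport {u} {v} (inj₁ p) (inj₂ (q , _)) adj =
      contradiction (ℕ.≤-trans q (ℕ.≤-trans (row-step {u} {v} adj) (s≤s p))) (ℕ.<-irrefl refl)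
    adj-transport {u} {v} (inj₂ (p , _)) (inj₁ q) adj =
      contradiction (ℕ.≤-trans p (ℕ.≤-trans (row-step {v} {u} (Graph.Adj-sym G {u} {v} adj)) (s≤s q)))
        (ℕ.<-irrefl refl)
    adj-transport {u} {v} (inj₂ (p , deep)) (inj₂ (q , _)) adj =
      subst₂ Adj (sym (transport-lower {u} p)) (sym (transport-lower {v} q))
        (adj-lower {proj₁ u} {proj₂ u} {proj₁ v} deep adj)

    module _ {i} (settled : Settled css i e e′) where

      place-transport : ∀ r t → toℕ (combine r t) ≤ toℕ i →
        transport (place e (combine r t)) ≡ place e′ (combine r t)
      place-transport r t le with settled r t le
      ... | inj₁ refl = trans (cong transport (place-Z e t)) (trans (transport-upper Z≤T) (sym (place-Z e′ t)))
      ... | inj₂ (refl , c , refl , q , deep) = begin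
        transport (place e (combine (σ ⟨$⟩ʳ R) (ord e ⟨$⟩ʳ c)))  ≡⟨ cong transport (place-R e c) ⟩
        transport (R , pos e ⟨$⟩ʳ c)
          ≡⟨ transport-lower (ℕ.≤-trans (ℕ.m≤m+n (2 + T) T) R≥) ⟩
        (R , shift (pos e ⟨$⟩ʳ c))
          ≡⟨ cong (λ x → R , pos e′ ⟨$⟩ʳ x) (inverseˡ (pos e)) ⟩
        (R , pos e′ ⟨$⟩ʳ c)                                      ≡⟨ place-R e′ c ⟨
        place e′ (combine (σ ⟨$⟩ʳ R) (ord e′ ⟨$⟩ʳ c))
          ≡⟨ cong (λ t → place e′ (combine (σ ⟨$⟩ʳ R) t)) q ⟩
        place e′ (combine (σ ⟨$⟩ʳ R) (ord e ⟨$⟩ʳ c))             ∎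
        where open ≡-Reasoning

      walk-transport : ∀ r t {v} → toℕ (combine r t) ≤ toℕ i → Dist≤ G T (place e (combine r t)) v →
        Dist≤ G T (place e′ (combine r t)) (transport v) × (Upper v ⊎ Lower v)
      walk-transport r t {v} le d with settled r t le
      ... | inj₁ refl = subst₂ (Dist≤ G T) (sym (place-Z e′ t)) (sym (transport-upper {v} up)) d′ , inj₁ up
        where
        d′ : Dist≤ G T (Z , t) v
        d′ = subst (λ u → Dist≤ G T u v) (place-Z e t) d
        up : Upper v
        up = walk-upper d′ (subst (λ z → z + T ≤ T) (sym Z≡0) ℕ.≤-refl)
      ... | inj₂ (refl , c , refl , q , deep) =
        let d′ , low = walk-lower (subst (λ u → Dist≤ G T u v) (place-R e c) d) R≥
                         (subst (Deep css T) (sym (inverseˡ (pos e))) deep)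
        in subst₂ (Dist≤ G T) place≡ (sym (transport-lower {v} (proj₁ low))) d′ , inj₂ low
        where
        place≡ : (R , shift (pos e ⟨$⟩ʳ c)) ≡ place e′ (combine (σ ⟨$⟩ʳ R) (ord e ⟨$⟩ʳ c))
        place≡ = trans (cong (λ x → R , pos e′ ⟨$⟩ʳ x) (inverseˡ (pos e)))
          (trans (sym (place-R e′ c)) (cong (λ t → place e′ (combine (σ ⟨$⟩ʳ R) t)) q))

      seen-transport : ∀ {v} → Seen e i v → Seen e′ i (transport v) × (Upper v ⊎ Lower v)
      seen-transport seen with Any-take-tabulate⁻ (suc (toℕ i)) (place e) seen
      ... | j , lt , d with Fin.combine-surjective {m} {m} j
      ... | r , t , refl =
        let d′ , zone = walk-transport r t (s≤s⁻¹ lt) d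
        in Any-take-tabulate⁺ (suc (toℕ i)) (place e′) (combine r t) lt d′ , zone

      ident-transport : ∀ v → label (unlocate e′ (transport v)) ≡ label (unlocate e v)
      ident-transport v = cong label (unlocate-locate e′ (unlocate e v))

  open Adversary using (viewAt)
  open Graph G using (any-V?; Adj?)

  Node : Layout → Fin (m * m) → Fin (size (m * m)) → Set
  Node e i x = ∃[ u ] (label (unlocate e u) ≡ x × Seen e i u)

  Edge : Layout → Fin (m * m) → Fin (size (m * m)) → Fin (size (m * m)) → Set
  Edge e i x y = ∃[ u ] ∃[ v ] (label (unlocate e u) ≡ x × label (unlocate e v) ≡ y ×
                                Seen e i u × Seen e i v × Adj u v)

  seen? : ∀ e i u → Dec (Seen e i u)
  seen? e i = Ball? G (Adversary.upTo (adversary e) i) T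

  node? : ∀ e i x → Dec (Node e i x)
  node? e i x = any-V? λ u → (label (unlocate e u) Fin.≟ x) ×-dec seen? e i u

  edge? : ∀ e i x y → Dec (Edge e i x y)
  edge? e i x y = any-V? λ u → any-V? λ v →
    (label (unlocate e u) Fin.≟ x) ×-dec (label (unlocate e v) Fin.≟ y) ×-dec
    seen? e i u ×-dec seen? e i v ×-dec Adj? u v

  -- Transport carries every revealed node and edge into the other view with its identifiers. As
  -- `Settled` is symmetric in the layouts, the converse is the same argument.
  view-unique : ∀ {css i e e′} → Fits css (pos e) → Fits css (pos e′) → Settled css i e e′ →
    viewAt (adversary e) T i ≡ viewAt (adversary e′) T i
  view-unique {css} {i} {e} {e′} fits fits′ settled = cong₃
    (map-take-tabulate (suc (toℕ i)) _ _ (place e) (place e′) λ j lt → presented j (s≤s⁻¹ lt))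
    (Vec.tabulate-cong λ x → does-⇔
      (mk⇔ (carry-node e e′ fits fits′ settled) (carry-node e′ e fits′ fits settled′))
      (node? e i x) (node? e′ i x))
    (Vec.tabulate-cong λ x → Vec.tabulate-cong λ y → does-⇔
      (mk⇔ (carry-edge e e′ fits fits′ settled) (carry-edge e′ e fits′ fits settled′))
      (edge? e i x y) (edge? e′ i x y))
    where
    settled′ : Settled css i e′ e
    settled′ = Settled-sym {css} {i} {e} {e′} settled
    cong₃ : ∀ {N} {p p′ n n′ a a′} → p ≡ p′ → n ≡ n′ → a ≡ a′ → mkView {N} p n a ≡ mkView p′ n′ a′
    cong₃ refl refl refl = refl
    presented : ∀ j → toℕ j ≤ toℕ i → label (unlocate e (place e j)) ≡ label (unlocate e′ (place e′ j))
    presented j le with Fin.combine-surjective {m} {m} j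
    ... | r , t , refl = trans (sym (Transport.ident-transport {css} {e} {e′} fits fits′ settled _))
      (cong (label ∘ unlocate e′) (Transport.place-transport {css} {e} {e′} fits fits′ settled r t le))
    carry-node : ∀ e e′ → Fits css (pos e) → Fits css (pos e′) → Settled css i e e′ → ∀ {x} →
      Node e i x → Node e′ i x
    carry-node e e′ f f′ s (u , eq , seen) =
      T.transport u , trans (T.ident-transport s u) eq , proj₁ (T.seen-transport s seen)
      where module T = Transport {css} {e} {e′} f f′
    carry-edge : ∀ e e′ → Fits css (pos e) → Fits css (pos e′) → Settled css i e e′ → ∀ {x y} →
      Edge e i x y → Edge e′ i x y
    carry-edge e e′ f f′ s (u , v , eqᵤ , eqᵥ , seenᵤ , seenᵥ , adj) =
      T.transport u , T.transport v , trans (T.ident-transport s u) eqᵤ , trans (T.ident-transport s v) eqᵥ ,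
      proj₁ (T.seen-transport s seenᵤ) , proj₁ (T.seen-transport s seenᵥ) ,
      T.adj-transport {u} {v} (proj₂ (T.seen-transport s seenᵤ)) (proj₂ (T.seen-transport s seenᵥ)) adj
      where module T = Transport {css} {e} {e′} f f′

-- Stretches of columns and how they are joined.

-- A seed is one column with margins of `T + 1` columns on both sides; a join uses two smaller
-- stretches and at most one extra column to correct the parity.
need : ℕ → ℕ → ℕ
need T zero    = suc T + suc (suc T)
need T (suc k) = suc (need T k + need T k)

split : ∀ {A : Set} n (xs : List A) → n ≤ length xs → ∃[ ys ] ∃[ zs ] (xs ≡ ys ++ zs × length ys ≡ n)
split zero    xs       _        = [] , xs , refl , refl
split (suc n) (x ∷ xs) (s≤s le) with split n xs le
... | ys , zs , eq , len = x ∷ ys , zs , cong (x ∷_) eq , cong suc len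

module _ {m : ℕ} where

  Near-sym : ∀ (f : Fin m → Fin m) {a b} → Near f a b → Near f b a
  Near-sym f {a} {b} near = trans (ℕ.∣-∣-comm (toℕ (f b)) (toℕ (f a))) near

  At-concat : ∀ {f : Fin m → Fin m} {n} css → At f n (concat css) → All (Linked (Near f)) css
  At-concat []         _  = []
  At-concat (cs ∷ css) at = At⇒Linked cs (At-++⁻ˡ cs at) ∷ At-concat css (At-++⁻ʳ cs at)

  -- The stretch is a zipper focused on `c`, and each unit of depth moves the focus one column left
  -- or right. Distinctness of the columns separates the two neighbours of the focus.
  Deep-zipper : ∀ {cs css} t xs c ys → Unique cs → t < length xs → t < length ys → cs ≡ xs ʳ++ c ∷ ys →
    Deep (cs ∷ css) t c
  Deep-zipper {cs} {css} t (a ∷ xs) c (b ∷ ys) uniq t<xs t<ys eq = go t t<xs t<ys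
    where
    a≢b : a ≢ b
    a≢b with Unique-++⁻ʳ xs (Unique-resp-↭ (↭-trans (↭-reflexive eq) (↭-sym (++↭ʳ++ xs (a ∷ c ∷ b ∷ ys)))) uniq)
    ... | (_ ∷ a≢b ∷ _) ∷ _ = a≢b
    forced : ∀ π → Fits (cs ∷ css) π → Near (π ⟨$⟩ʳ_) c a × Near (π ⟨$⟩ʳ_) c b
    forced π (linked ∷ _) with Linked-ʳ++⁻ xs (subst (Linked (Near (π ⟨$⟩ʳ_))) eq linked)
    ... | ac ∷ cb ∷ _ = Near-sym (π ⟨$⟩ʳ_) {a} {c} ac , cb
    go : ∀ t → t < suc (length xs) → t < suc (length ys) → Deep (cs ∷ css) t c
    go zero    _          _          = a , b , a≢b , (λ π → proj₁ ∘ forced π) , (λ π → proj₂ ∘ forced π)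
    go (suc t) (s≤s t<xs) (s≤s t<ys) =
      a , b , a≢b , (λ π → proj₁ ∘ forced π) , (λ π → proj₂ ∘ forced π) ,
      Deep-zipper t xs a (c ∷ b ∷ ys) uniq t<xs (ℕ.m<n⇒m<1+n (ℕ.m<n⇒m<1+n t<ys)) eq ,
      Deep-zipper t (c ∷ a ∷ xs) b ys uniq (ℕ.m<n⇒m<1+n (ℕ.m<n⇒m<1+n t<xs)) t<ys eq

  Deep-middle : ∀ {css} t u seg v → Unique (u ++ seg ++ v) → t < length u → t < length v →
    All (Deep ((u ++ seg ++ v) ∷ css) t) seg
  Deep-middle {css} t u seg v uniq t<u t<v =
    go (reverse u) seg (subst (t <_) (sym (List.length-reverse u)) t<u)
      (sym (trans (List.ʳ++-defn (reverse u)) (cong (_++ (seg ++ v)) (List.reverse-involutive u))))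
    where
    go : ∀ xs ys → t < length xs → u ++ seg ++ v ≡ xs ʳ++ ys ++ v →
      All (Deep ((u ++ seg ++ v) ∷ css) t) ys
    go xs []       _    _  = []
    go xs (c ∷ ys) t<xs eq =
      Deep-zipper t xs c (ys ++ v) uniq t<xs
        (ℕ.<-≤-trans t<v (subst (length v ≤_) (sym (List.length-++ ys)) (ℕ.m≤n+m _ _))) eq
      ∷ go (c ∷ xs) ys (ℕ.m<n⇒m<1+n t<xs) eq

-- A stretch of columns u ++ seg ++ v of which seg, at distance more than T from both ends,
-- has been presented in row R.
record Piece (m T n : ℕ) (supply : List (Fin m)) : Set where
  field
    u seg v new taken rest : List (Fin m)
    supply≡ : supply ≡ taken ++ rest
    taken≤  : length taken ≤ n
    body↭   : u ++ seg ++ v ↭ taken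
    new↭    : new ↭ seg
    u≡      : length u ≡ suc T
    v≡      : length v ≡ suc T

  body : List (Fin m)
  body = u ++ seg ++ v

open Piece

reverse-++-++ : ∀ {A : Set} (xs ys zs : List A) →
  reverse (xs ++ ys ++ zs) ≡ reverse zs ++ reverse ys ++ reverse xs
reverse-++-++ xs ys zs = trans (List.reverse-++ xs (ys ++ zs))
  (trans (cong (_++ reverse xs) (List.reverse-++ ys zs)) (List.++-assoc (reverse zs) (reverse ys) (reverse xs)))

module _ {m T : ℕ} where

  open import Algebra.Solver.CommutativeMonoid (++-commutativeMonoid {A = Fin m})
    using (_⊕_; _⊜_) renaming (solve to ↭-solve)

  open import Algebra.Solver.Monoid (List.++-monoid (Fin m))
    using () renaming (solve to ++-solve; _⊕_ to _⊛_; _⊜_ to _⊜′_)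

  single : ∀ {supply} → need T 0 ≤ length supply →
    Σ[ P ∈ Piece m T (need T 0) supply ] ∃[ p ] (seg P ≡ [ p ])
  single {supply} le with split (suc T) supply (ℕ.≤-trans (ℕ.m≤m+n (suc T) _) le)
  ... | us , rest₁ , refl , us≡ with split 1 rest₁ (ℕ.≤-trans (s≤s z≤n) le₁)
    where
    le₁ : suc (suc T) ≤ length rest₁
    le₁ =
      ℕ.+-cancelˡ-≤ (suc T) _ _ (subst (need T 0 ≤_) (trans (List.length-++ us) (cong (_+ length rest₁) us≡)) le)
  ... | p ∷ [] , rest₂ , refl , _ with split (suc T) rest₂ le₂
    where
    le₂ : suc T ≤ length rest₂
    le₂ = s≤s⁻¹ (ℕ.+-cancelˡ-≤ (suc T) _ _
      (subst (need T 0 ≤_) (trans (List.length-++ us) (cong (_+ suc (length rest₂)) us≡)) le))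
  ... | vs , rest₃ , refl , vs≡ = record
    { u = us
    ; seg = [ p ]
    ; v = vs
    ; new = [ p ]
    ; taken = us ++ p ∷ vs
    ; rest = rest₃
    ; supply≡ = sym (List.++-assoc us (p ∷ vs) rest₃)
    ; taken≤ = ℕ.≤-reflexive (trans (List.length-++ us) (cong₂ (λ a b → a + suc b) us≡ vs≡))
    ; body↭ = ↭-refl
    ; new↭ = ↭-refl
    ; u≡ = us≡
    ; v≡ = vs≡
    } , p , refl

  -- The inner margins and the padding `f` are presented last. Thus the new presentation order
  -- extends that of `P` followed by `Q`, and what was coloured for them stays valid; the outer
  -- margins remain unpresented.
  join : ∀ {n supply} (P : Piece m T n supply) (Q : Piece m T n (rest P)) f s → rest Q ≡ f ++ s →
    length f ≤ 1 →
    Piece m T (suc (n + n)) supply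
  join {n} P Q f s eq f≤1 = record
    { u = u P
    ; seg = seg P ++ v P ++ f ++ u Q ++ seg Q
    ; v = v Q
    ; new = new P ++ new Q ++ v P ++ f ++ u Q
    ; taken = taken P ++ taken Q ++ f
    ; rest = s
    ; supply≡ = trans (supply≡ P) (trans (cong (taken P ++_) (trans (supply≡ Q) (cong (taken Q ++_) eq)))
        (++-solve 4 (λ a b c d → (a ⊛ (b ⊛ (c ⊛ d))) ⊜′ ((a ⊛ b ⊛ c) ⊛ d)) refl (taken P) (taken Q) f s))
    ; taken≤ = ℕ.≤-trans (ℕ.≤-reflexive (trans (List.length-++ (taken P))
        (cong (λ z → length (taken P) + z) (List.length-++ (taken Q)))))
        (ℕ.≤-trans (ℕ.+-mono-≤ (taken≤ P) (ℕ.+-mono-≤ (taken≤ Q) f≤1))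
          (ℕ.≤-reflexive (trans (sym (ℕ.+-assoc n n 1)) (ℕ.+-comm (n + n) 1))))
    ; body↭ = ↭-trans (↭-solve 7
        (λ a b c d e f g → (a ⊕ (b ⊕ c ⊕ d ⊕ e ⊕ f) ⊕ g) ⊜ ((a ⊕ b ⊕ c) ⊕ (e ⊕ f ⊕ g) ⊕ d)) ↭-refl
                        (u P) (seg P) (v P) f (u Q) (seg Q) (v Q)) (++⁺ (body↭ P) (++⁺ (body↭ Q) ↭-refl))
    ; new↭ = ↭-trans (++⁺ (new↭ P) (++⁺ (new↭ Q) ↭-refl))
        (↭-solve 5 (λ b f c d e → (b ⊕ f ⊕ c ⊕ d ⊕ e) ⊜ (b ⊕ c ⊕ d ⊕ e ⊕ f)) ↭-refl (seg P) (seg Q) (v P) f (u Q))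
    ; u≡ = u≡ P
    ; v≡ = v≡ Q
    }

  -- `new` and `taken` are untouched: the history of presentations is the same whichever way the
  -- stretch is finally laid down.
  flipped : ∀ {n supply} → Piece m T n supply → Piece m T n supply
  flipped P = record
    { u = reverse (v P)
    ; seg = reverse (seg P)
    ; v = reverse (u P)
    ; new = new P
    ; taken = taken P
    ; rest = rest P
    ; supply≡ = supply≡ P
    ; taken≤ = taken≤ P
    ; body↭ = ↭-trans (++⁺ (↭-reverse (v P)) (++⁺ (↭-reverse (seg P)) (↭-reverse (u P))))
        (↭-trans (↭-solve 3 (λ a b c → (c ⊕ b ⊕ a) ⊜ (a ⊕ b ⊕ c)) ↭-refl (u P) (seg P) (v P)) (body↭ P))
    ; new↭ = ↭-trans (new↭ P) (↭-sym (↭-reverse (seg P)))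
    ; u≡ = trans (List.length-reverse (v P)) (v≡ P)
    ; v≡ = trans (List.length-reverse (u P)) (u≡ P)
    }

  -- Two separate uniqueness conditions, since stretches contain margins that are absent from `ps`:
  -- the first lets `arrange` assign positions, the second times.
  record Good (css : List (List (Fin m))) (ps supply : List (Fin m)) : Set where
    field
      css-unique : Unique (concat css ++ supply)
      ps-unique  : Unique (ps ++ supply)
      deep       : All (Deep css T) ps

  open Good

  extend : ∀ {n css ps supply} → Good css ps supply → (P : Piece m T n supply) →
    Good (body P ∷ css) (ps ++ new P) (rest P)
  extend {n} {css} {ps} {supply} g P = record
    { css-unique = css-unique′
    ; ps-unique  = Unique-++⁻ʳ (u P ++ v P) (Unique-resp-↭
        (↭-trans (++⁺ (↭-refl {x = ps}) (↭-trans (↭-reflexive (supply≡ P)) (++⁺ (↭-sym (body↭ P)) ↭-refl)))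
        (↭-trans (↭-solve 5 (λ p a b c r → (p ⊕ ((a ⊕ b ⊕ c) ⊕ r)) ⊜ ((a ⊕ c) ⊕ (p ⊕ b) ⊕ r)) ↭-refl
            ps (u P) (seg P) (v P) (rest P))
          (++⁺ (↭-refl {x = u P ++ v P}) (++⁺ (++⁺ (↭-refl {x = ps}) (↭-sym (new↭ P))) ↭-refl)))) (ps-unique g))
    ; deep = All.++⁺ (All.map (Deep-mono (λ _ → All.tail) T) (deep g))
        (All-resp-↭ (↭-sym (new↭ P)) (Deep-middle T (u P) (seg P) (v P) body-unique
          (ℕ.≤-reflexive (sym (u≡ P))) (ℕ.≤-reflexive (sym (v≡ P)))))
    }
    where
    css-unique′ : Unique (concat (body P ∷ css) ++ rest P)
    css-unique′ = Unique-resp-↭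
      (↭-trans (++⁺ (↭-refl {x = concat css}) (↭-trans (↭-reflexive (supply≡ P)) (++⁺ (↭-sym (body↭ P)) ↭-refl)))
        (↭-solve 3 (λ a b c → (a ⊕ b ⊕ c) ⊜ ((b ⊕ a) ⊕ c)) ↭-refl (concat css) (body P) (rest P))) (css-unique g)
    body-unique : Unique (body P)
    body-unique = Unique-++⁻ˡ (body P) (Unique-++⁻ˡ (body P ++ concat css) css-unique′)

-- Parity padding and heights of concatenated paths.

snoc-view : ∀ {A : Set} (x : A) xs → ∃[ ys ] ∃[ y ] (x ∷ xs ≡ ys ++ [ y ])
snoc-view x []        = [] , x , refl
snoc-view x (x′ ∷ xs) with snoc-view x′ xs
... | ys , y , eq = x ∷ ys , y , cong (x ∷_) eq

-- The spare element is inserted exactly when the sum would otherwise be even; the choice depends on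
-- lengths only, not on colours.
pad : ∀ {A B : Set} (g : List A → List B) → (∀ x → length (g [ x ]) ≡ suc (length (g []))) → ∀ k s →
  1 ≤ length s →
  ∃[ f ] ∃[ s′ ] (s ≡ f ++ s′ × length f ≤ 1 × (∀ j → length (g f) + k ≢ 2 * j))
pad g g≡ k (x ∷ s) _ with even⊎odd (length (g []) + k)
... | inj₂ (i , eq) = [] , x ∷ s , refl , z≤n , λ j eq′ → ℕ.even≢odd j i (trans (sym eq′) eq)
... | inj₁ (i , eq) = [ x ] , s , refl , s≤s z≤n , λ j eq′ → ℕ.even≢odd j i
  (trans (sym eq′) (trans (cong (_+ k) (g≡ x)) (cong suc eq)))

module _ {A : Set} (h : A → Fin 3) where

  rise-map-++ : ∀ xs a ys →
    rise (map h (xs ++ a ∷ ys)) ≡ rise (map h (xs ++ [ a ])) +ℤ rise (map h (a ∷ ys))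
  rise-map-++ xs a ys = trans (cong rise (List.map-++ h xs (a ∷ ys)))
    (trans (rise-++ (map h xs) (h a) (map h ys))
      (cong (λ l → rise l +ℤ rise (map h (a ∷ ys))) (sym (List.map-++ h xs [ a ]))))

  rise-chain : ∀ xs a ys b zs → rise (map h ((xs ++ [ a ]) ++ ys ++ b ∷ zs)) ≡
    rise (map h (xs ++ [ a ])) +ℤ (rise (map h (a ∷ ys ++ [ b ])) +ℤ rise (map h (b ∷ zs)))
  rise-chain xs a ys b zs = trans (cong (rise ∘ map h) (List.++-assoc xs [ a ] (ys ++ b ∷ zs)))
    (trans (rise-map-++ xs a (ys ++ b ∷ zs))
      (cong (rise (map h (xs ++ [ a ])) +ℤ_) (rise-map-++ (a ∷ ys) b zs)))

  rise-map-reverse : ∀ xs → rise (map h (reverse xs)) ≡ - rise (map h xs)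
  rise-map-reverse xs = trans (cong rise (List.reverse-map h xs)) (rise-reverse (map h xs))

-- Forcing a large rise in row `R`.

module Game (I : IdentifierSpace) (m : ℕ) (A : Algorithm I 3) (proper : ProperlyColors A (simpleGrid m m))
  (Z R : Fin m) (Z≡0 : toℕ Z ≡ 0) (R≡ : toℕ R ≡ 2 + Algorithm.locality A (m * m) + Algorithm.locality A (m * m)) where

  open Algorithm A

  T : ℕ
  T = locality (m * m)

  open Layouts I m T Z R Z≡0 R≡
  open Graph G using (V; Adj)

  abstract
    colour : Layout → V → Fin 3
    colour e = run A G (adversary e)

    colour-proper : ∀ e {v w} → Adj v w → colour e v ≢ colour e w
    colour-proper e = proper (adversary e)

    -- Outside this block colours obey two facts only: properness, and agreement of nodes that are
    -- presented at the same time in settled layouts.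
    colour-unique : ∀ {css e e′ v v′} i → time e v ≡ i → time e′ v′ ≡ i →
      Fits css (pos e) → Fits css (pos e′) → Settled css i e e′ → colour e v ≡ colour e′ v′
    colour-unique {css} {e} {e′} i refl eq fits fits′ settled =
      trans (cong (output (m * m)) (view-unique {css} {i} {e} {e′} fits fits′ settled))
        (cong (λ i → output (m * m) (Adversary.viewAt (adversary e′) T i)) (sym eq))

  hue : Layout → Fin m → Fin 3
  hue e c = colour e (R , pos e ⟨$⟩ʳ c)

  record Compatible (css : List (List (Fin m))) (ps : List (Fin m)) (e : Layout) : Set where
    constructor compatible
    field
      fits  : Fits css (pos e)
      order : At (ord e ⟨$⟩ʳ_) 0 ps

  open Compatible

  abstract
    -- The constraints are always satisfiable, by laying the stretches side by side from position 0.
    compatible-layout : ∀ {css ps supply} → Good {m} {T} css ps supply → ∃[ e ] Compatible css ps e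
    compatible-layout {css} {ps} g =
      let π , at , _ = arrange 0 (concat css) Perm.id (Unique-++⁻ˡ _ (Good.css-unique g)) (All.universal (λ _ → z≤n) _)
          ρ , at′ , _ =
            arrange 0 ps Perm.id (Unique-++⁻ˡ _ (Good.ps-unique g)) (All.universal (λ _ → z≤n) _)
      in layout π ρ , compatible (At-concat css at) at′

  top-unique : ∀ e e′ x → colour e (Z , x) ≡ colour e′ (Z , x)
  top-unique e e′ x = colour-unique {[]} {e} {e′} _ (time-Z e x) (time-Z e′ x) [] [] settled
    where
    settled : Settled [] (combine (σ ⟨$⟩ʳ Z) x) e e′
    settled r t le with Fin.<-cmp (σ ⟨$⟩ʳ Z) r
    ... | tri≈ _ eq _ = inj₁ (sym eq)
    ... | tri< lt _ _ = contradiction le (ℕ.<⇒≱ (Fin.combine-monoˡ-< x t lt))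
    ... | tri> _ _ gt = contradiction gt (ℕ.n≮0 ∘ subst (toℕ r <_) σZ)

  -- Whatever row `R` has presented by the time of `c` is itself in `ps`, hence deep and equally
  -- timed in both layouts.
  hue-unique : ∀ {css ps supply e e′ c} → Good {m} {T} css ps supply → Compatible css ps e →
    Compatible css ps e′ →
    c ∈ ps → hue e c ≡ hue e′ c
  hue-unique {css} {ps} {_} {e} {e′} {c} g C C′ c∈ =
    colour-unique {css} {e} {e′} _ (time-R e c)
      (trans (time-R e′ c) (cong (combine (σ ⟨$⟩ʳ R)) (At-agree (order C′) (order C) c∈)))
      (fits C) (fits C′) settled
    where
    settled : Settled css (combine (σ ⟨$⟩ʳ R) (ord e ⟨$⟩ʳ c)) e e′
    settled r t le with Fin.<-cmp (σ ⟨$⟩ʳ R) r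
    ... | tri< lt _ _ = contradiction le (ℕ.<⇒≱ (Fin.combine-monoˡ-< (ord e ⟨$⟩ʳ c) t lt))
    ... | tri> _ _ gt = inj₁ (Fin.toℕ-injective
            (trans (ℕ.n<1⇒n≡0 (subst (toℕ r <_) σR gt)) (sym σZ)))
    ... | tri≈ _ refl _ =
      let d , d∈ , p , q = At-index ps (order C) (order C′) z≤n (ℕ.≤-<-trans t≤ (proj₂ (At-bound (order C) c∈)))
      in inj₂ (refl , d , Fin.toℕ-injective p , Fin.toℕ-injective q , All.lookup (Good.deep g) d∈)
      where
      t≤ : toℕ t ≤ toℕ (ord e ⟨$⟩ʳ c)
      t≤ =
        ℕ.+-cancelˡ-≤ (m * toℕ (σ ⟨$⟩ʳ R)) _ _
          (subst₂ _≤_ (Fin.toℕ-combine (σ ⟨$⟩ʳ R) t) (Fin.toℕ-combine (σ ⟨$⟩ʳ R) (ord e ⟨$⟩ʳ c)) le)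

  height : Layout → List (Fin m) → ℤ
  height e path = rise (map (hue e) path)

  -- `rises` ranges over all compatible layouts because the place and direction of the piece are
  -- still open, even though the colours on it are determined.
  record Rising (k : ℕ) (css : List (List (Fin m))) (ps supply : List (Fin m)) : Set where
    field
      piece       : Piece m T (need T k) supply
      before      : List (Fin m)
      p           : Fin m
      path after  : List (Fin m)
      seg≡        : Piece.seg piece ≡ before ++ (p ∷ path) ++ after
      rises       : ∀ e → Compatible (Piece.body piece ∷ css) (ps ++ Piece.new piece) e → + k ≤ℤ height e (p ∷ path)

  height-unique : ∀ {n css ps supply e e′ before path after} → Good {m} {T} css ps supply →
    (P : Piece m T n supply) →
    Piece.seg P ≡ before ++ path ++ after →
    Compatible (Piece.body P ∷ css) (ps ++ Piece.new P) e → Compatible (Piece.body P ∷ css) (ps ++ Piece.new P) e′ →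
    height e path ≡ height e′ path
  height-unique {ps = ps} {e = e} {e′} {before} {path} {after} g P eq C C′ =
   cong rise (List.map-cong-local {xs = path} (All.tabulate λ {c} c∈ →
    hue-unique {e = e} {e′} (extend g P) C C′ (∈-++⁺ʳ ps (∈-resp-↭ (↭-sym (Piece.new↭ P))
      (subst (c ∈_) (sym eq) (∈-++⁺ʳ before (∈-++⁺ˡ c∈)))))))

  adj-R : ∀ {r x y} → Near {m} (λ z → z) x y → Adj (r , x) (r , y)
  adj-R {r} near = cong₂ _+_ (ℕ.∣n-n∣≡0 (toℕ r)) near

  hue-proper : ∀ e {cs} → Linked (Near (pos e ⟨$⟩ʳ_)) cs → Linked _≢_ (map (hue e) cs)
  hue-proper e linked = Linked.map⁺ (Linked.map (λ {a} {b} near → colour-proper e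
    {R , pos e ⟨$⟩ʳ a} {R , pos e ⟨$⟩ʳ b} (adj-R {R} {pos e ⟨$⟩ʳ a} near)) linked)

  -- By `height-unique`, a bound observed in one compatible layout holds in all.
  rising : ∀ {k css ps supply} → Good {m} {T} css ps supply → (P : Piece m T (need T k) supply) →
    ∀ before p path after →
    Piece.seg P ≡ before ++ (p ∷ path) ++ after → ∀ e → Compatible (Piece.body P ∷ css) (ps ++ Piece.new P) e →
    + k ≤ℤ height e (p ∷ path) → Rising k css ps supply
  rising g P before p path after eq e C le = record
    { piece = P ; before = before ; p = p ; path = path ; after = after ; seg≡ = eq
    ; rises = λ e′ C′ → subst (_ ≤ℤ_) (height-unique {e = e} {e′} {before} {p ∷ path} {after} g P eq C C′) le
    }

  flip-compatible : ∀ {n css ps supply} (P : Piece m T n supply) → ∀ {e} →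
    Compatible (Piece.body P ∷ css) ps e → Compatible (Piece.body (flipped P) ∷ css) ps e
  flip-compatible P {e} (compatible (linked ∷ fits) at) = compatible
    (subst (Linked _) (reverse-++-++ (Piece.u P) (Piece.seg P) (Piece.v P))
      (Linked-reverse (λ {a} {b} → Near-sym (pos e ⟨$⟩ʳ_) {a} {b}) linked) ∷ fits) at

  module Merge {k css ps supply} (g : Good {m} {T} css ps supply) (P : Rising k css ps supply)
    (Q : Rising k (Piece.body (Rising.piece P) ∷ css) (ps ++ Piece.new (Rising.piece P)) (Piece.rest (Rising.piece P)))
    (1≤ : 1 ≤ length (Piece.rest (Rising.piece Q))) where

    open ≡-Reasoning
    open import Algebra.Solver.Monoid (List.++-monoid (Fin m))
      using (_⊕_; _⊜_) renaming (solve to ++-solve)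
    module P = Rising P
    module Q = Rising Q
    module PP = Piece P.piece
    module QQ = Piece Q.piece

    r : Fin m
    r = Q.p

    -- Besides the inner margins and the padding, the gap contains the columns of both pieces beyond
    -- their rising paths; all of them count for the parity.
    gap : List (Fin m) → List (Fin m)
    gap f = P.after ++ (PP.v ++ f ++ QQ.u) ++ Q.before

    gap-length : ∀ x → length (gap [ x ] ++ [ r ]) ≡ suc (length (gap [] ++ [ r ]))
    gap-length x =
      trans (cong length {gap [ x ] ++ [ r ]} {(P.after ++ PP.v) ++ x ∷ (QQ.u ++ Q.before ++ [ r ])}
        (++-solve 6 (λ a b c d e f → ((a ⊕ (b ⊕ c ⊕ d) ⊕ e) ⊕ f) ⊜ ((a ⊕ b) ⊕ (c ⊕ (d ⊕ e ⊕ f)))) refl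
          P.after PP.v [ x ] QQ.u Q.before [ r ]))
      (trans (List.length-++-sucʳ (P.after ++ PP.v) x _) (cong (suc ∘ length)
        (++-solve 5 (λ a b d e f → ((a ⊕ b) ⊕ (d ⊕ e ⊕ f)) ⊜ ((a ⊕ (b ⊕ d) ⊕ e) ⊕ f)) refl
          P.after PP.v QQ.u Q.before [ r ])))

    padding : ∃[ f ] ∃[ s ] (QQ.rest ≡ f ++ s × length f ≤ 1 × (∀ j →
      length (gap f ++ [ r ]) + k ≢ 2 * j))
    padding = pad (λ f → gap f ++ [ r ]) gap-length k QQ.rest 1≤

    f s : List (Fin m)
    f = proj₁ padding
    s = proj₁ (proj₂ padding)

    PQ : Piece m T (need T (suc k)) supply
    PQ =
      join P.piece Q.piece f s (proj₁ (proj₂ (proj₂ padding))) (proj₁ (proj₂ (proj₂ (proj₂ padding))))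

    module PQ = Piece PQ

    init : List (Fin m)
    init = proj₁ (snoc-view P.p P.path)

    q : Fin m
    q = proj₁ (proj₂ (snoc-view P.p P.path))

    init≡ : P.p ∷ P.path ≡ init ++ [ q ]
    init≡ = proj₂ (proj₂ (snoc-view P.p P.path))

    -- Shares its end columns with the two rising paths, so the three rises add up. It has
    -- `length (gap f ++ [ r ])` edges, the number whose parity `padding` controls.
    bridge : List (Fin m)
    bridge = q ∷ gap f ++ [ r ]

    seg≡₀ : PQ.seg ≡ (P.before ++ (init ++ [ q ]) ++ P.after) ++ PP.v ++ f ++ QQ.u ++
      Q.before ++ (r ∷ Q.path) ++ Q.after
    seg≡₀ = cong₂ (λ a b → a ++ PP.v ++ f ++ QQ.u ++ b)
      (trans P.seg≡ (cong (λ l → P.before ++ l ++ P.after) init≡)) Q.seg≡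

    seg≡-bridge : PQ.seg ≡ (P.before ++ init) ++ bridge ++ (Q.path ++ Q.after)
    seg≡-bridge = trans seg≡₀ (++-solve 11 (λ a b c d e f g h i j k →
      ((a ⊕ (b ⊕ c) ⊕ d) ⊕ e ⊕ f ⊕ g ⊕ h ⊕ (i ⊕ j) ⊕ k) ⊜
      ((a ⊕ b) ⊕ (c ⊕ ((d ⊕ (e ⊕ f ⊕ g) ⊕ h) ⊕ i)) ⊕ (j ⊕ k))) refl
      P.before init [ q ] P.after PP.v f QQ.u Q.before [ r ] Q.path Q.after)

    seg≡-path : PQ.seg ≡ P.before ++ (P.p ∷ P.path ++ gap f ++ r ∷ Q.path) ++ Q.after
    seg≡-path = trans seg≡₀ (trans (++-solve 11 (λ a b c d e f g h i j k →
      ((a ⊕ (b ⊕ c) ⊕ d) ⊕ e ⊕ f ⊕ g ⊕ h ⊕ (i ⊕ j) ⊕ k) ⊜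
      (a ⊕ ((b ⊕ c) ⊕ ((d ⊕ (e ⊕ f ⊕ g) ⊕ h) ⊕ (i ⊕ j))) ⊕ k)) refl
      P.before init [ q ] P.after PP.v f QQ.u Q.before [ r ] Q.path Q.after)
      (cong (λ l → P.before ++ (l ++ gap f ++ r ∷ Q.path) ++ Q.after) (sym init≡)))

    body≡ : PQ.body ≡ PP.body ++ f ++ QQ.body
    body≡ =
      ++-solve 7 (λ a b c d e f g → (a ⊕ (b ⊕ c ⊕ d ⊕ e ⊕ f) ⊕ g) ⊜ ((a ⊕ b ⊕ c) ⊕ d ⊕ (e ⊕ f ⊕ g))) refl
      PP.u PP.seg PP.v f QQ.u QQ.seg QQ.v

    -- Any layout of the join keeps both smaller stretches intact and presents them in the original
    -- order, so the bounds known for `P` and `Q` apply to it.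
    restrictQ : ∀ {e} → Compatible (PQ.body ∷ css) (ps ++ PQ.new) e →
      Compatible (QQ.body ∷ PP.body ∷ css) ((ps ++ PP.new) ++ QQ.new) e
    restrictQ {e} (compatible (linked ∷ fits) at) = compatible
      (Linked-++⁻ʳ f (Linked-++⁻ʳ PP.body linked′) ∷ Linked-++⁻ˡ PP.body linked′ ∷ fits)
      (At-++⁻ˡ ((ps ++ PP.new) ++ QQ.new) (subst (At (ord e ⟨$⟩ʳ_) 0)
        (++-solve 4 (λ a b c d → (a ⊕ (b ⊕ c ⊕ d)) ⊜ (((a ⊕ b) ⊕ c) ⊕ d)) refl
          ps PP.new QQ.new (PP.v ++ f ++ QQ.u)) at))
      where
      linked′ : Linked (Near (pos e ⟨$⟩ʳ_)) (PP.body ++ f ++ QQ.body)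
      linked′ = subst (Linked _) body≡ linked

    restrictP : ∀ {e} → Compatible (PQ.body ∷ css) (ps ++ PQ.new) e →
      Compatible (PP.body ∷ css) (ps ++ PP.new) e
    restrictP C with restrictQ C
    ... | compatible (_ ∷ fits) at = compatible fits (At-++⁻ˡ (ps ++ PP.new) at)

    bridge-linked : ∀ {e} → Compatible (PQ.body ∷ css) (ps ++ PQ.new) e →
      Linked (Near (pos e ⟨$⟩ʳ_)) bridge
    bridge-linked (compatible (linked ∷ _) _) = Linked-++⁻ˡ bridge (Linked-++⁻ʳ (P.before ++ init)
      (subst (Linked _) seg≡-bridge (Linked-++⁻ˡ PQ.seg (Linked-++⁻ʳ PQ.u linked))))

    bridge≢ : ∀ {e} → Compatible (PQ.body ∷ css) (ps ++ PQ.new) e → height e bridge ≢ - + k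
    bridge≢ {e} C = rise≢ k (hue-proper e (bridge-linked C)) λ j eq →
      proj₂ (proj₂ (proj₂ (proj₂ padding))) j
        (trans (cong (_+ k) (sym (List.length-map (hue e) (gap f ++ [ r ])))) eq)

    bridge-reverse : reverse bridge ≡ r ∷ reverse (q ∷ gap f)
    bridge-reverse = List.reverse-++ (q ∷ gap f) [ r ]

    seg≡-reverse : reverse PQ.seg ≡
      reverse (Q.path ++ Q.after) ++ (r ∷ reverse (q ∷ gap f)) ++ reverse (P.before ++ init)
    seg≡-reverse =
      trans (cong reverse seg≡-bridge) (trans (reverse-++-++ (P.before ++ init) bridge (Q.path ++ Q.after))
      (cong (λ l → reverse (Q.path ++ Q.after) ++ l ++ reverse (P.before ++ init)) bridge-reverse))

    height-path : ∀ e → height e (P.p ∷ P.path) +ℤ (height e bridge +ℤ height e (r ∷ Q.path)) ≡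
      height e (P.p ∷ P.path ++ gap f ++ r ∷ Q.path)
    height-path e = begin
      height e (P.p ∷ P.path) +ℤ (height e bridge +ℤ height e (r ∷ Q.path))
        ≡⟨ cong (λ l → height e l +ℤ (height e bridge +ℤ height e (r ∷ Q.path))) init≡ ⟩
      height e (init ++ [ q ]) +ℤ (height e bridge +ℤ height e (r ∷ Q.path))
        ≡⟨ rise-chain (hue e) init q (gap f) r Q.path ⟨
      height e ((init ++ [ q ]) ++ gap f ++ r ∷ Q.path)
        ≡⟨ cong (λ l → height e (l ++ gap f ++ r ∷ Q.path)) init≡ ⟨
      height e (P.p ∷ P.path ++ gap f ++ r ∷ Q.path) ∎

    height-reverse : ∀ e → - height e bridge ≡ height e (r ∷ reverse (q ∷ gap f))
    height-reverse e = trans (sym (rise-map-reverse (hue e) bridge)) (cong (height e) bridge-reverse)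

    forward : ∀ e → Compatible (PQ.body ∷ css) (ps ++ PQ.new) e →
      + suc k ≤ℤ height e (P.p ∷ P.path) +ℤ (height e bridge +ℤ height e (r ∷ Q.path)) → Rising (suc k) css ps supply
    forward e C le = rising g PQ P.before P.p (P.path ++ gap f ++ r ∷ Q.path) Q.after seg≡-path e C
      (subst (+ suc k ≤ℤ_) (height-path e) le)

    -- The gap descends too steeply, so the whole piece is reversed and the reversed bridge becomes
    -- the rising path.
    backward : ∀ e → Compatible (PQ.body ∷ css) (ps ++ PQ.new) e → + suc k ≤ℤ - height e bridge →
      Rising (suc k) css ps supply
    backward e C le = rising g (flipped PQ)
      (reverse (Q.path ++ Q.after)) r (reverse (q ∷ gap f)) (reverse (P.before ++ init)) seg≡-reverse
      e (flip-compatible PQ C) (subst (+ suc k ≤ℤ_) (height-reverse e) le)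

    merged : Rising (suc k) css ps supply
    merged =
      let e , C = compatible-layout (extend g PQ)
      in [ forward e C , backward e C ]′
           (join-rise k {height e (P.p ∷ P.path)} {height e bridge} {height e (r ∷ Q.path)}
             (P.rises e (restrictP C)) (Q.rises e (restrictQ C)) (bridge≢ C))

  rest-length : ∀ {n a supply} (P : Piece m T n supply) → n + a ≤ length supply →
    a ≤ length (Piece.rest P)
  rest-length {n} {a} P le = ℕ.+-cancelˡ-≤ n _ _ (ℕ.≤-trans le (ℕ.≤-trans
    (ℕ.≤-reflexive (trans (cong length (Piece.supply≡ P)) (List.length-++ (Piece.taken P))))
    (ℕ.+-monoˡ-≤ _ (Piece.taken≤ P))))

  build : ∀ k {css ps supply} → Good {m} {T} css ps supply → need T k ≤ length supply →
    Rising k css ps supply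
  build zero g le with single le
  ... | P , p , eq = record
    { piece = P ; before = [] ; p = p ; path = [] ; after = [] ; seg≡ = eq ; rises = λ _ _ → ℤ.≤-refl }
  build (suc k) {css} {ps} {supply} g le = Merge.merged g P Q (rest-length (Rising.piece Q) le₂)
    where
    n : ℕ
    n = need T k
    le₁ : n + (n + 1) ≤ length supply
    le₁ = subst (_≤ length supply) (trans (ℕ.+-comm 1 (n + n)) (ℕ.+-assoc n n 1)) le
    P : Rising k css ps supply
    P = build k g (ℕ.≤-trans (ℕ.m≤m+n n _) le₁)
    le₂ : n + 1 ≤ length (Piece.rest (Rising.piece P))
    le₂ = rest-length (Rising.piece P) le₁
    Q : Rising k _ _ (Piece.rest (Rising.piece P))
    Q = build k (extend g (Rising.piece P)) (ℕ.≤-trans (ℕ.m≤m+n n 1) le₂)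

  -- Comparison with row 0, and the contradiction.

  rowHeight : Layout → Fin m → List (Fin m) → ℤ
  rowHeight e r path = rise (map (λ c → colour e (r , pos e ⟨$⟩ʳ c)) path)

  rowHeight-adjacent : ∀ e {r r′ p path} → ∣ toℕ r - toℕ r′ ∣ ≡ 1 →
    Linked (Near (pos e ⟨$⟩ʳ_)) (p ∷ path) →
    rowHeight e r (p ∷ path) ≤ℤ rowHeight e r′ (p ∷ path) +ℤ + 2
  rowHeight-adjacent e {r} {r′} eq linked = rise-parallel _ _ (Linked.map (λ {a} {b} near →
    let x = pos e ⟨$⟩ʳ a ; y = pos e ⟨$⟩ʳ b in
    colour-proper e {r , x} {r , y} (adj-R {r} {x} near) , colour-proper e {r′ , x} {r′ , y} (adj-R {r′} {x} near) ,
    colour-proper e {r , x} {r′ , x} (vertical x) , colour-proper e {r , y} {r′ , y} (vertical y)) linked)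
    where
    vertical : ∀ x → Adj (r , x) (r′ , x)
    vertical x = cong₂ _+_ eq (ℕ.∣n-n∣≡0 (toℕ x))

  -- Each row crossed costs 2. Both directions are used: the forward placement bounds row `Z` from
  -- below, the backward one from above.
  rowHeight-top : ∀ e n {r p path} → toℕ r ≡ n → Linked (Near (pos e ⟨$⟩ʳ_)) (p ∷ path) →
    rowHeight e r (p ∷ path) ≤ℤ rowHeight e Z (p ∷ path) +ℤ + (2 * n) ×
    rowHeight e Z (p ∷ path) ≤ℤ rowHeight e r (p ∷ path) +ℤ + (2 * n)
  rowHeight-top e zero {r} r≡ linked with Fin.toℕ-injective {i = r} {j = Z} (trans r≡ (sym Z≡0))
  ... | refl = ℤ.≤-reflexive (sym (ℤ.+-identityʳ _)) , ℤ.≤-reflexive (sym (ℤ.+-identityʳ _))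
  rowHeight-top e (suc n) {r} {p} {path} r≡ linked =
    (begin
      h r                          ≤⟨ rowHeight-adjacent e {r} {r′} above linked ⟩
      h r′ +ℤ + 2                  ≤⟨ ℤ.+-monoˡ-≤ (+ 2) (proj₁ ih) ⟩
      h Z +ℤ + (2 * n) +ℤ + 2      ≡⟨ two-more (h Z) ⟩
      h Z +ℤ + (2 * suc n)         ∎) ,
    (begin
      h Z                          ≤⟨ proj₂ ih ⟩
      h r′ +ℤ + (2 * n)
        ≤⟨ ℤ.+-monoˡ-≤ (+ (2 * n)) (rowHeight-adjacent e {r′} {r}
             (trans (ℕ.∣-∣-comm (toℕ r′) (toℕ r)) above) linked) ⟩
      h r +ℤ + 2 +ℤ + (2 * n)      ≡⟨ swap (h r) (+ 2) (+ (2 * n)) ⟩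
      h r +ℤ + (2 * n) +ℤ + 2      ≡⟨ two-more (h r) ⟩
      h r +ℤ + (2 * suc n)         ∎)
    where
    open ℤ.≤-Reasoning
    h : Fin m → ℤ
    h r = rowHeight e r (p ∷ path)
    n<m : n < m
    n<m = ℕ.≤-trans (ℕ.≤-reflexive (sym r≡)) (ℕ.<⇒≤ (Fin.toℕ<n r))
    r′ : Fin m
    r′ = fromℕ< n<m
    ih : h r′ ≤ℤ h Z +ℤ + (2 * n) × h Z ≤ℤ h r′ +ℤ + (2 * n)
    ih = rowHeight-top e n (Fin.toℕ-fromℕ< n<m) linked
    above : ∣ toℕ r - toℕ r′ ∣ ≡ 1
    above =
      trans (cong₂ ∣_-_∣ r≡ (Fin.toℕ-fromℕ< n<m))
        (trans (cong ∣_- n ∣ (sym (ℕ.+-comm n 1))) (trans (ℕ.∣-∣-comm (n + 1) n) (ℕ.∣m-m+n∣≡n n 1)))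
    swap : ∀ a b c → a +ℤ b +ℤ c ≡ a +ℤ c +ℤ b
    swap = ℤ-Ring.solve-∀
    two-more : ∀ a → a +ℤ + (2 * n) +ℤ + 2 ≡ a +ℤ + (2 * suc n)
    two-more a = trans (ℤ.+-assoc a (+ (2 * n)) (+ 2))
      (cong (λ z → a +ℤ + z) (trans (ℕ.+-comm (2 * n) 2) (sym (ℕ.*-suc 2 n))))

  initial : Good {m} {T} [] [] (allFin m)
  initial = record { css-unique = Unique.allFin⁺ m ; ps-unique = Unique.allFin⁺ m ; deep = [] }

  abstract
    place-body : ∀ {n} (P : Piece m T n (allFin m)) k cs → cs ↭ Piece.taken P →
      k ≤ length (Piece.rest P) →
      ∃[ e ] (At (pos e ⟨$⟩ʳ_) k cs × At (ord e ⟨$⟩ʳ_) 0 (Piece.new P))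
    place-body P k cs cs↭ k≤ =
      let f , s , rest≡ , f≡ = split k (Piece.rest P) k≤
          e , C = compatible-layout (extend initial P)
          unique = Unique-++⁻ˡ (f ++ cs) (Unique-resp-↭
            (↭-trans (↭-reflexive (trans (Piece.supply≡ P) (cong (Piece.taken P ++_) rest≡)))
              (↭-trans (++⁺ (↭-sym cs↭) ↭-refl) (↭-solve 3 (λ a b c → (a ⊕ (b ⊕ c)) ⊜ ((b ⊕ a) ⊕ c)) ↭-refl cs f s)))
            (Unique.allFin⁺ m))
          π , at , _ = arrange 0 (f ++ cs) Perm.id unique (All.universal (λ _ → z≤n) _)
      in layout π (ord e) ,
         subst (λ k → At (π ⟨$⟩ʳ_) k cs) (trans (ℕ.+-identityʳ _) f≡) (At-++⁻ʳ f at) , order C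
      where
      open import Algebra.Solver.CommutativeMonoid (++-commutativeMonoid {A = Fin m})
        using (_⊕_; _⊜_) renaming (solve to ↭-solve)

  At-middle : ∀ {f k} us {vs seg} xs {ys zs} → seg ≡ xs ++ ys ++ zs → At {m} f k (us ++ seg ++ vs) →
    At f (length xs + (length us + k)) ys
  At-middle us {seg = seg} xs {ys} refl at = At-++⁻ˡ ys (At-++⁻ʳ xs (At-++⁻ˡ seg (At-++⁻ʳ us at)))

  module Contradiction (P : Rising (suc (2 * toℕ R)) [] [] (allFin m))
    (room : need T (suc (2 * toℕ R)) ≤ length (Piece.rest (Rising.piece P))) where

    module P = Rising P
    module PP = Piece P.piece

    K : ℕ
    K = suc (2 * toℕ R)

    y : ℤ
    y = + (2 * toℕ R)

    path : List (Fin m)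
    path = P.p ∷ P.path

    body-length : length PP.u + (length P.before + (length path + length P.after) + length PP.v) ≤ need T K
    body-length = ℕ.≤-trans (ℕ.≤-reflexive (trans (sym lengths) (↭-length PP.body↭))) PP.taken≤
      where
      lengths : length PP.body ≡ length PP.u + (length P.before + (length path + length P.after) + length PP.v)
      lengths = trans (List.length-++ PP.u) (cong (λ z → length PP.u + z) (trans (List.length-++ PP.seg)
        (cong (_+ length PP.v) (trans (cong length P.seg≡) (trans (List.length-++ P.before)
          (cong (λ z → length P.before + z) (List.length-++ path)))))))

    after-fits : length P.after + length PP.v ≤ length PP.rest
    after-fits =
      ℕ.≤-trans (ℕ.≤-trans (ℕ.+-monoˡ-≤ _ (ℕ.≤-trans (ℕ.m≤n+m _ (length path)) (ℕ.m≤n+m _ (length P.before))))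
      (ℕ.≤-trans (ℕ.m≤n+m _ (length PP.u)) body-length)) room

    before-fits : length P.before + length PP.u ≤ length PP.rest
    before-fits = ℕ.≤-trans (ℕ.≤-trans (ℕ.≤-reflexive (ℕ.+-comm (length P.before) (length PP.u)))
      (ℕ.≤-trans (ℕ.+-monoʳ-≤ (length PP.u) (ℕ.≤-trans (ℕ.m≤m+n _ _) (ℕ.m≤m+n _ (length PP.v)))) body-length)) room

    -- The offset is the length of what precedes the path in the opposite placement. Each way,
    -- `before`, `u`, `after` and `v` together precede the path, so the path and its reversal cover
    -- the same positions under row `Z`.
    place₁ : ∃[ e ] (At (pos e ⟨$⟩ʳ_) (length P.after + length PP.v) PP.body × At (ord e ⟨$⟩ʳ_) 0 PP.new)
    place₁ = place-body P.piece (length P.after + length PP.v) PP.body PP.body↭ after-fits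

    place₂ : ∃[ e ] (At (pos e ⟨$⟩ʳ_) (length P.before + length PP.u) (Piece.body (flipped P.piece)) ×
      At (ord e ⟨$⟩ʳ_) 0 PP.new)
    place₂ =
      place-body P.piece (length P.before + length PP.u) (Piece.body (flipped P.piece))
        (Piece.body↭ (flipped P.piece)) before-fits

    e₁ e₂ : Layout
    e₁ = proj₁ place₁
    e₂ = proj₁ place₂

    C₁ : Compatible (PP.body ∷ []) PP.new e₁
    C₁ = compatible (At⇒Linked PP.body (proj₁ (proj₂ place₁)) ∷ []) (proj₂ (proj₂ place₁))

    C₂ : Compatible (PP.body ∷ []) PP.new e₂
    C₂ = compatible (subst (Linked _) (List.reverse-involutive PP.body)
      (Linked-reverse (λ {a} {b} → Near-sym (pos e₂ ⟨$⟩ʳ_) {a} {b})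
        (subst (Linked _) (sym (reverse-++-++ PP.u PP.seg PP.v)) (At⇒Linked _ (proj₁ (proj₂ place₂))))) ∷ [])
      (proj₂ (proj₂ place₂))

    position : ℕ
    position = length P.before + (length PP.u + (length P.after + length PP.v))

    at₁ : At (pos e₁ ⟨$⟩ʳ_) position path
    at₁ = At-middle PP.u P.before P.seg≡ (proj₁ (proj₂ place₁))

    at₂ : At (pos e₂ ⟨$⟩ʳ_) position (reverse path)
    at₂ = subst (λ k → At (pos e₂ ⟨$⟩ʳ_) k (reverse path))
      (trans (cong₂ (λ a b → a + (b + (length P.before + length PP.u))) (List.length-reverse P.after)
        (List.length-reverse PP.v))
        (lemma (length P.after) (length PP.v) (length P.before) (length PP.u)))
      (At-middle (reverse PP.v) (reverse P.after)
        (trans (cong reverse P.seg≡) (reverse-++-++ P.before path P.after)) (proj₁ (proj₂ place₂)))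
      where
      lemma : ∀ a b c d → a + (b + (c + d)) ≡ c + (d + (a + b))
      lemma = ℕ-Ring.solve-∀

    top≡ : rowHeight e₁ Z path ≡ rowHeight e₂ Z (reverse path)
    top≡ = cong rise (begin
      map (λ c → colour e₁ (Z , pos e₁ ⟨$⟩ʳ c)) path               ≡⟨ List.map-∘ path ⟩
      map (λ x → colour e₁ (Z , x)) (map (pos e₁ ⟨$⟩ʳ_) path)
        ≡⟨ List.map-cong (top-unique e₁ e₂) _ ⟩
      map (λ x → colour e₂ (Z , x)) (map (pos e₁ ⟨$⟩ʳ_) path)
        ≡⟨ cong (map _) (At-unique path (reverse path) (sym (List.length-reverse path)) at₁ at₂) ⟩
      map (λ x → colour e₂ (Z , x)) (map (pos e₂ ⟨$⟩ʳ_) (reverse path)) ≡⟨ List.map-∘ (reverse path) ⟨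
      map (λ c → colour e₂ (Z , pos e₂ ⟨$⟩ʳ c)) (reverse path)     ∎)
      where open ≡-Reasoning

    reverse-cons : ∃[ p ] ∃[ ps ] reverse path ≡ p ∷ ps
    reverse-cons with snoc-view P.p P.path
    ... | ys , z , eq = z , reverse ys , trans (cong reverse eq) (List.reverse-++ ys [ z ])

    top≤ : rowHeight e₂ Z (reverse path) ≤ℤ height e₂ (reverse path) +ℤ y
    top≤ with reverse-cons
    ... | p , ps , eq = subst (λ l → rowHeight e₂ Z l ≤ℤ height e₂ l +ℤ y) (sym eq)
      (proj₂ (rowHeight-top e₂ (toℕ R) refl (subst (Linked _) eq (At⇒Linked _ at₂))))

    -- Below one and the same segment of row `Z`, row `R` rises by at least `K` in `e₁` and by at
    -- most `- K` in `e₂`, and each differs from row `Z` by at most `y`. As `K` is `y + 1`, this is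
    -- absurd.
    K+K≤y+y : + K +ℤ + K ≤ℤ y +ℤ y
    K+K≤y+y = begin
      + K +ℤ + K                                 ≤⟨ ℤ.+-monoʳ-≤ (+ K) (P.rises e₁ C₁) ⟩
      + K +ℤ height e₁ path
        ≤⟨ ℤ.+-monoʳ-≤ (+ K) (proj₁ (rowHeight-top e₁ (toℕ R) refl (At⇒Linked path at₁))) ⟩
      + K +ℤ (rowHeight e₁ Z path +ℤ y)          ≡⟨ cong (λ h → + K +ℤ (h +ℤ y)) top≡ ⟩
      + K +ℤ (rowHeight e₂ Z (reverse path) +ℤ y) ≤⟨ ℤ.+-monoʳ-≤ (+ K) (ℤ.+-monoˡ-≤ y top≤) ⟩
      + K +ℤ (height e₂ (reverse path) +ℤ y +ℤ y)
        ≡⟨ cong (λ h → + K +ℤ (h +ℤ y +ℤ y)) (rise-map-reverse (hue e₂) path) ⟩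
      + K +ℤ (- height e₂ path +ℤ y +ℤ y)
        ≤⟨ ℤ.+-monoʳ-≤ (+ K) (ℤ.+-monoˡ-≤ y (ℤ.+-monoˡ-≤ y (ℤ.neg-mono-≤ (P.rises e₂ C₂)))) ⟩
      + K +ℤ (- + K +ℤ y +ℤ y)                   ≡⟨ lemma (+ K) y ⟩
      y +ℤ y                                     ∎
      where
      open ℤ.≤-Reasoning
      lemma : ∀ a b → a +ℤ (- a +ℤ b +ℤ b) ≡ b +ℤ b
      lemma = ℤ-Ring.solve-∀

    contra : ⊥
    contra = ℕ.<-irrefl refl (ℕ.<-≤-trans (ℕ.+-mono-< (ℕ.n<1+n _) (ℕ.n<1+n _)) (ℤ.drop‿+≤+ K+K≤y+y))

  -- One half of the width supplies the stretch, the other half the columns that shift it into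
  -- place.
  impossible : ¬ (need T (suc (2 * toℕ R)) + need T (suc (2 * toℕ R)) ≤ m)
  impossible le = Contradiction.contra P (rest-length (Rising.piece P) le′)
    where
    K : ℕ
    K = suc (2 * toℕ R)
    le′ : need T K + need T K ≤ length (allFin m)
    le′ = subst (need T K + need T K ≤_) (sym (List.length-tabulate {n = m} λ i → i)) le
    P : Rising K [] [] (allFin m)
    P = build K initial (ℕ.≤-trans (ℕ.m≤m+n _ _) le′)

-- From the width bound to the logarithmic lower bound.

-- Adding 1 turns the recurrence of `need` into plain doubling.
suc-need : ∀ T k → suc (need T k) ≡ 2 ^ k * (T + T + 4)
suc-need T zero    = lemma T
  where
  lemma : ∀ T → suc (suc T + suc (suc T)) ≡ 1 * (T + T + 4)
  lemma = ℕ-Ring.solve-∀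
suc-need T (suc k) =
  trans (lemma₁ (need T k)) (trans (cong (2 *_) (suc-need T k)) (lemma₂ (2 ^ k) (T + T + 4)))
  where
  lemma₁ : ∀ n → suc (suc (n + n)) ≡ 2 * suc n
  lemma₁ = ℕ-Ring.solve-∀
  lemma₂ : ∀ a b → 2 * (a * b) ≡ 2 * a * b
  lemma₂ = ℕ-Ring.solve-∀

n<2^n : ∀ n → n < 2 ^ n
n<2^n zero    = s≤s z≤n
n<2^n (suc n) =
  ℕ.≤-trans (s≤s (n<2^n n)) (ℕ.≤-trans (ℕ.+-monoˡ-≤ (2 ^ n) (ℕ.≤-trans (s≤s z≤n) (n<2^n n)))
  (ℕ.≤-reflexive (cong (λ z → 2 ^ n + z) (sym (ℕ.+-identityʳ (2 ^ n))))))

2T+4≤ : ∀ T → T + T + 4 ≤ 2 ^ (T + 2)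
2T+4≤ T = ℕ.≤-trans (ℕ.≤-reflexive (lemma T)) (ℕ.≤-trans (ℕ.*-monoʳ-≤ 2 (n<2^n (suc T)))
  (ℕ.≤-reflexive (cong (2 ^_) (ℕ.+-comm 2 T))))
  where
  lemma : ∀ T → T + T + 4 ≡ 2 * suc (suc T)
  lemma = ℕ-Ring.solve-∀

-- The exponent collects `4T + 5` doublings, `T + 2` for the seed with its margins, and 1 for the
-- second half of the width.
need-bound : ∀ T → let K = suc (2 * (2 + T + T)) in need T K + need T K ≤ 2 ^ (8 + 5 * T)
need-bound T = begin
  need T K + need T K         ≤⟨ ℕ.+-mono-≤ (ℕ.n≤1+n (need T K)) (ℕ.n≤1+n (need T K)) ⟩
  suc (need T K) + suc (need T K) ≡⟨ cong (λ z → z + z) (suc-need T K) ⟩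
  2 ^ K * (T + T + 4) + 2 ^ K * (T + T + 4)
    ≤⟨ ℕ.+-mono-≤ (ℕ.*-monoʳ-≤ (2 ^ K) (2T+4≤ T)) (ℕ.*-monoʳ-≤ (2 ^ K) (2T+4≤ T)) ⟩
  2 ^ K * 2 ^ (T + 2) + 2 ^ K * 2 ^ (T + 2) ≡⟨ cong (λ z → z + z) (ℕ.^-distribˡ-+-* 2 K (T + 2)) ⟨
  2 ^ (K + (T + 2)) + 2 ^ (K + (T + 2)) ≡⟨ cong (λ z → 2 ^ (K + (T + 2)) + z) (ℕ.+-identityʳ _) ⟨
  2 ^ suc (K + (T + 2))       ≡⟨ cong (2 ^_) (lemma T) ⟩
  2 ^ (8 + 5 * T)             ∎
  where
  open ℕ.≤-Reasoning
  K : ℕ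
  K = suc (2 * (2 + T + T))
  lemma : ∀ T → suc (suc (2 * (2 + T + T)) + (T + 2)) ≡ 8 + 5 * T
  lemma = ℕ-Ring.solve-∀

m²≤n²⇒m≤n : ∀ {m n} → m * m ≤ n * n → m ≤ n
m²≤n²⇒m≤n {m} {n} le = ℕ.≮⇒≥ λ lt → ℕ.<⇒≱ (ℕ.*-mono-< lt lt) le

2^2n : ∀ n → 2 ^ (n + n) ≡ 2 ^ n * 2 ^ n
2^2n n = ℕ.^-distribˡ-+-* 2 n n

-- The case T ≤ 1 needs n₀ = 2 ^ 26; for T ≥ 2 the exponent 10 T dominates 8 + 5 T.
width-bound : ∀ T m → 2 ^ 26 ≤ m * m → 20 * T < ⌈log₂ m * m ⌉ → 2 ^ (8 + 5 * T) ≤ m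
width-bound T m big log> with T ≤? 1
... | yes T≤1 = ℕ.≤-trans (ℕ.^-monoʳ-≤ 2 (ℕ.+-monoʳ-≤ 8 (ℕ.*-monoʳ-≤ 5 T≤1)))
  (m²≤n²⇒m≤n (subst (_≤ m * m) (2^2n 13) big))
... | no  T≰1 = ℕ.≤-trans (ℕ.^-monoʳ-≤ 2 exponent) (m²≤n²⇒m≤n (subst (_≤ m * m) eq (ℕ.<⇒≤ large)))
  where
  large : 2 ^ (20 * T) < m * m
  large = ℕ.≰⇒> λ le → ℕ.<⇒≱ log> (subst (⌈log₂ m * m ⌉ ≤_) (⌈log₂2^n⌉≡n (20 * T)) (⌈log₂⌉-mono-≤ le))
  eq : 2 ^ (20 * T) ≡ 2 ^ (10 * T) * 2 ^ (10 * T)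
  eq = trans (cong (2 ^_) (ℕ.*-distribʳ-+ T 10 10)) (2^2n (10 * T))
  exponent : 8 + 5 * T ≤ 10 * T
  exponent = ℕ.≤-trans (ℕ.+-monoˡ-≤ (5 * T) (ℕ.≤-trans (ℕ.m≤m+n 8 2) (ℕ.*-monoʳ-≤ 5 (ℕ.≰⇒> T≰1))))
    (ℕ.≤-reflexive (sym (ℕ.*-distribʳ-+ T 5 5)))

-- By contraposition: with a smaller locality the grid has width at least `2 ^ (8 + 5 * T)`, so row
-- `2 + T + T` exists and the stretch fits together with its fillers.
log≤20T : ∀ I m (A : Algorithm I 3) → 2 ^ 26 ≤ m * m → ProperlyColors A (simpleGrid m m) →
  ⌈log₂ m * m ⌉ ≤ 20 * Algorithm.locality A (m * m)
log≤20T I m A big proper = ℕ.≮⇒≥ λ log> →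
  let wide = width-bound T m big log>
      0<m = ℕ.≤-trans (s≤s z≤n) (R<m wide)
  in Game.impossible I m A proper (fromℕ< 0<m) (fromℕ< (R<m wide)) (Fin.toℕ-fromℕ< 0<m) (Fin.toℕ-fromℕ< (R<m wide))
       (ℕ.≤-trans (subst (λ r → need T (suc (2 * r)) + need T (suc (2 * r)) ≤ 2 ^ (8 + 5 * T))
         (sym (Fin.toℕ-fromℕ< (R<m wide))) (need-bound T)) wide)
  where
  T : ℕ
  T = Algorithm.locality A (m * m)
  R<m : 2 ^ (8 + 5 * T) ≤ m → 2 + T + T < m
  R<m wide = ℕ.≤-trans (ℕ.≤-trans (ℕ.≤-reflexive (lemma T)) (ℕ.≤-trans (ℕ.n≤1+n _)
    (ℕ.≤-trans (ℕ.≤-reflexive (lemma′ T)) (ℕ.≤-trans (2T+4≤ T) (ℕ.^-monoʳ-≤ 2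
      (ℕ.≤-trans (ℕ.≤-reflexive (ℕ.+-comm T 2))
      (ℕ.+-mono-≤ (ℕ.m≤m+n 2 6) (ℕ.m≤n*m T 5)))))))) wide
    where
    lemma : ∀ T → suc (2 + T + T) ≡ T + T + 3
    lemma = ℕ-Ring.solve-∀
    lemma′ : ∀ T → suc (T + T + 3) ≡ T + T + 4
    lemma′ = ℕ-Ring.solve-∀

fraction-≤ : ∀ a b → a ≤ 20 * b → (+ 1 / 20) *ℚ (+ a / 1) ≤ℚ (+ b / 1)
fraction-≤ a b le = ℚ.toℚᵘ-cancel-≤ (begin
  toℚᵘ ((+ 1 / 20) *ℚ (+ a / 1))             ≃⟨ ℚ.toℚᵘ-homo-* (+ 1 / 20) (+ a / 1) ⟩
  toℚᵘ (+ 1 / 20) *ᵘ toℚᵘ (+ a / 1)      ≃⟨ ℚᵘ.*-congˡ (ℚ.toℚᵘ-fromℚᵘ (mkℚᵘ (+ a) 0)) ⟩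
  mkℚᵘ (+ 1) 19 *ᵘ mkℚᵘ (+ a) 0
    ≤⟨ *≤* (subst₂ ℤ._≤_ (sym lhs) (ℤ.pos-* b 20) (ℤ.+≤+ (subst (a ≤_) (ℕ.*-comm 20 b) le))) ⟩
  mkℚᵘ (+ b) 0                                 ≃⟨ ℚ.toℚᵘ-fromℚᵘ (mkℚᵘ (+ b) 0) ⟨
  toℚᵘ (+ b / 1)                             ∎)
  where
  open ℚᵘ.≤-Reasoning
  lhs : + 1 ℤ.* + a ℤ.* + 1 ≡ + a
  lhs = trans (ℤ.*-identityʳ (+ 1 ℤ.* + a)) (ℤ.*-identityˡ (+ a))

theorem1 : (I : IdentifierSpace) →
    ∃[ c ] (0ℚ <ℚ c × ∃[ n₀ ] (∀ (n m : ℕ) → n₀ ≤ n → n ≡ m * m →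
    (A : Algorithm I 3) → ProperlyColors A (simpleGrid m m) →
    c *ℚ (+ ⌈log₂ n ⌉ / 1) ≤ℚ (+ Algorithm.locality A n / 1)))
theorem1 I = + 1 / 20 , from-yes (0ℚ ℚ.<? (+ 1 / 20)) , 2 ^ 26 , λ { n m n₀≤n refl A proper →
  fraction-≤ ⌈log₂ n ⌉ (Algorithm.locality A n) (log≤20T I m A n₀≤n proper) }
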